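{- Let $n\ge2$. For $1\le k\le n-1$, the set $\{E_k\Delta_n\}$ is a basis of $A_n^{k,1}$, so $\dim A_n^{k,1}=1$. For every other integer $k$, $\dim A_n^{k,1}=0$.
   Context: $A_n$ is the space of $P\in\mathbb{Q}[x_1,\dots,x_n,y_1,\dots,y_n]$ with $\sum_{i=1}^n\partial_{x_i}^a\partial_{y_i}^bP=0$ for all $a,b\ge0$ with $a+b>0$, which are alternating under the diagonal action of $S_n$ ($\sigma P=P(x_{\sigma(1)},\dots,x_{\sigma(n)},y_{\sigma(1)},\dots,y_{\sigma(n)})=\mathrm{sgn}(\sigma)P$). $A_n^{k,l}$ is the subspace of elements bihomogeneous of degree $\frac{n(n-1)}2-k$ in the $x$'s and $l$ in the $y$'s. $\Delta_n=\det\big(x_i^{n-j}/(n-j)!\big)_{i,j=1}^n$ and $E_a=\sum_{i=1}^ny_i\partial_{x_i}^a$ for $a>0$. -}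

module Defs where

open import Data.Nat as ℕ using (ℕ; zero; suc; _∸_; _!; _<ᵇ_)
open import Data.Nat.Properties using (_!≢0)
import Data.Nat.Properties as ℕP
open import Data.Nat.DivMod using (_/_)
open import Data.Integer as ℤ using (ℤ; +_)
open import Data.Rational as ℚ using (ℚ; 0ℚ; 1ℚ)
open import Data.Rational.Properties using () renaming (_≟_ to _≟ℚ_)
open import Data.Fin as Fin using (Fin; toℕ)
open import Data.Fin.Permutation using (Permutation′; _⟨$⟩ʳ_; _⟨$⟩ˡ_)
open import Data.Vec as Vec using (Vec; []; _∷_; lookup; tabulate; updateAt)
import Data.Vec.Properties as VecP
open import Data.List as List using (List; []; _∷_; _++_; map; concatMap; allFin; foldr)
open import Data.Nat.ListAction using () renaming (sum to sumℕ)
open import Data.Bool.ListAction using () renaming (and to andL)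
open import Data.Bool using (Bool; true; false; if_then_else_; _∧_; not)
open import Data.Product using (_×_; _,_; proj₁; proj₂; Σ)
import Data.Product.Properties as ProdP
open import Relation.Nullary using (¬_; yes; no; does)
open import Relation.Binary.PropositionalEquality using (_≡_)

-- Polynomials in ℚ[x₁..xₙ, y₁..yₙ], represented as finite formal sums
-- of terms (coefficient, (x-exponents, y-exponents)).  Two polynomials
-- are equal (_≈_) iff all their coefficients agree.

Mono : ℕ → Set
Mono n = Vec ℕ n × Vec ℕ n

Poly : ℕ → Set
Poly n = List (ℚ × Mono n)

_≟M_ : ∀ {n} (e f : Mono n) → Relation.Nullary.Dec (e ≡ f)
_≟M_ = ProdP.≡-dec (VecP.≡-dec ℕ._≟_) (VecP.≡-dec ℕ._≟_)

coeff : ∀ {n} → Poly n → Mono n → ℚ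
coeff [] e = 0ℚ
coeff ((c , f) ∷ p) e = if does (f ≟M e) then c ℚ.+ coeff p e else coeff p e

_≈_ : ∀ {n} → Poly n → Poly n → Set
p ≈ q = ∀ e → coeff p e ≡ coeff q e

0P : ∀ {n} → Poly n
0P = []

1P : ∀ {n} → Poly n
1P {n} = (1ℚ , (Vec.replicate n 0 , Vec.replicate n 0)) ∷ []

_+P_ : ∀ {n} → Poly n → Poly n → Poly n
_+P_ = _++_

_·_ : ∀ {n} → ℚ → Poly n → Poly n
c · p = map (λ { (d , e) → (c ℚ.* d , e) }) p

_*P_ : ∀ {n} → Poly n → Poly n → Poly n
p *P q = concatMap (λ { (c , (ex , ey)) →
           map (λ { (d , (fx , fy)) → (c ℚ.* d , (Vec.zipWith ℕ._+_ ex fx , Vec.zipWith ℕ._+_ ey fy)) }) q }) p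

sumP : ∀ {n} → List (Poly n) → Poly n
sumP = foldr _+P_ 0P

prodP : ∀ {n} → List (Poly n) → Poly n
prodP = foldr _*P_ 1P

falling : ℕ → ℕ → ℕ
falling e zero = 1
falling zero (suc a) = 0
falling (suc e) (suc a) = suc e ℕ.* falling e a

ℕtoℚ : ℕ → ℚ
ℕtoℚ m = (+ m) ℚ./ 1

∂ : ∀ {n} → Fin n → ℕ → ℕ → Poly n → Poly n
∂ i a b = map (λ { (c , (ex , ey)) →
  (c ℚ.* ℕtoℚ (falling (lookup ex i) a) ℚ.* ℕtoℚ (falling (lookup ey i) b)
  , (updateAt ex i (λ m → m ∸ a) , updateAt ey i (λ m → m ∸ b))) })

mulY : ∀ {n} → Fin n → Poly n → Poly n
mulY i = map (λ { (c , (ex , ey)) → (c , (ex , updateAt ey i suc)) })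

E : ∀ {n} → ℕ → Poly n → Poly n
E {n} a P = sumP (map (λ i → mulY i (∂ i a 0 P)) (allFin n))

negOnePow : ℕ → ℚ
negOnePow zero = 1ℚ
negOnePow (suc m) = ℚ.- negOnePow m

inversions : ∀ {n} → (Fin n → Fin n) → ℕ
inversions {n} f = sumℕ (map (λ i → sumℕ (map (λ j →
  if (toℕ i <ᵇ toℕ j) ∧ (toℕ (f j) <ᵇ toℕ (f i)) then 1 else 0) (allFin n))) (allFin n))

sgnFun : ∀ {n} → (Fin n → Fin n) → ℚ
sgnFun f = negOnePow (inversions f)

sgn : ∀ {n} → Permutation′ n → ℚ
sgn σ = sgnFun (σ ⟨$⟩ʳ_)

-- σP = P(x_{σ(1)},…,x_{σ(n)}, y_{σ(1)},…,y_{σ(n)}):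
-- the monomial ∏ xᵢ^{eᵢ} becomes ∏ x_{σ i}^{eᵢ}
act : ∀ {n} → Permutation′ n → Poly n → Poly n
act σ = map (λ { (c , (ex , ey)) →
  (c , (tabulate (λ j → lookup ex (σ ⟨$⟩ˡ j)) , tabulate (λ j → lookup ey (σ ⟨$⟩ˡ j)))) })

allVecs : ∀ {n} (m : ℕ) → List (Vec (Fin n) m)
allVecs zero = [] ∷ []
allVecs {n} (suc m) = concatMap (λ v → map (_∷ v) (allFin n)) (allVecs m)

injectiveᵇ : ∀ {n} → Vec (Fin n) n → Bool
injectiveᵇ {n} v = andL (map (λ i → andL (map (λ j →
  if does (i Fin.≟ j) then true else not (does (lookup v i Fin.≟ lookup v j))) (allFin n))) (allFin n))

perms : (n : ℕ) → List (Vec (Fin n) n)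
perms n = List.filterᵇ injectiveᵇ (allVecs n)

det : ∀ {n} → (Fin n → Fin n → Poly n) → Poly n
det {n} M = sumP (map (λ v → sgnFun (lookup v) · prodP (map (λ i → M i (lookup v i)) (allFin n))) (perms n))

xPowFact : ∀ {n} → Fin n → ℕ → Poly n
xPowFact {n} i m = (((+ 1) ℚ./ (m !)) {{m !≢0}} , (updateAt (Vec.replicate n 0) i (λ _ → m) , Vec.replicate n 0)) ∷ []

-- Δₙ = det (x_i^{n-j}/(n-j)!)_{i,j=1..n}  (with 0-based j: exponent n-1-j)
Δ : (n : ℕ) → Poly n
Δ n = det (λ i j → xPowFact i (n ∸ 1 ∸ toℕ j))

xdeg ydeg : ∀ {n} → Mono n → ℕ
xdeg (ex , ey) = Vec.sum ex
ydeg (ex , ey) = Vec.sum ey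

Harmonic : ∀ {n} → Poly n → Set
Harmonic {n} P = ∀ (a b : ℕ) → 0 ℕ.< a ℕ.+ b →
  sumP (map (λ i → ∂ i a b P) (allFin n)) ≈ 0P

Alternating : ∀ {n} → Poly n → Set
Alternating {n} P = ∀ (σ : Permutation′ n) → act σ P ≈ (sgn σ · P)

Bihom : ∀ (n : ℕ) → ℤ → ℕ → Poly n → Set
Bihom n k l P = ∀ (e : Mono n) → ¬ (coeff P e ≡ 0ℚ) →
  ((+ xdeg e) ≡ (+ (n ℕ.* (n ∸ 1) / 2)) ℤ.- k) × (ydeg e ≡ l)

InA : ∀ (n : ℕ) → ℤ → ℕ → Poly n → Set
InA n k l P = Harmonic P × Alternating P × Bihom n k l P

-- {b} is a basis of the subspace V (a predicate closed under ≈, linear ops)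
IsBasis₁ : ∀ {n} → (Poly n → Set) → Poly n → Set
IsBasis₁ V b = V b × ¬ (b ≈ 0P) × (∀ P → V P → Σ ℚ (λ c → P ≈ (c · b)))

IsZeroSpace : ∀ {n} → (Poly n → Set) → Set
IsZeroSpace V = ∀ P → V P → P ≈ 0P

{-# OPTIONS --safe #-}
module Submission where

-- A polynomial in x and y is encoded by its divided power coefficients, i.e. the coefficients
-- multiplied by the factorials of the exponents; a derivative then acts as a shift of the
-- exponents.  An element P of A_n^{k,1} becomes a family q i (i = 1 … n) of functions on
-- exponent vectors, the coefficients of y_i.  Vanishing under all ∑ ∂_{x_i}^a forces every
-- exponent to be < n (Newton's identities: x_i^n lies in the ideal of the power sums), and
-- antisymmetry makes the exponents of the x_j, j ≠ i, distinct, so they miss exactly one value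
-- in 0 … n-1.  With ∑ ∂_{x_l} a nonzero coefficient can be moved to one whose exponent of x_i
-- is 0; by degree the missing value is then k.  These coefficients form a single orbit of S_n,
-- so P is determined by one of them, and E_k Δ_n has a nonzero one.  For k = 0 the condition
-- ∑ ∂_{y_i} P = 0 kills it.

open import Defs
open import Data.Nat using (ℕ; _≤_; _∸_)
open import Data.Product using (_×_)
open import Relation.Nullary using (¬_)

open import Algebra.Bundles using (CommutativeRing)
import Algebra.Properties.CommutativeMonoid.Sum as MonoidSum
import Algebra.Properties.Group as GroupP
import Algebra.Properties.Semiring.Sum as SemiringSum
open import Data.Bool using (Bool; true; false; if_then_else_; _∧_; not)
open import Data.Bool.ListAction using () renaming (and to andL)
open import Data.Fin using (Fin; zero; suc; toℕ; fromℕ<; opposite; punchOut)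
import Data.Fin as Fin
open import Data.Fin.Permutation
  using (Permutation′; permutation; _⟨$⟩ʳ_; _⟨$⟩ˡ_; inverseˡ; inverseʳ; flip; _∘ₚ_)
import Data.Fin.Permutation as Perm
import Data.Fin.Permutation.Components as PC
import Data.Fin.Properties as FinP
import Data.Integer as ℤ
open import Data.Integer using (ℤ)
import Data.Integer.Properties as ℤP
open import Data.List using (List; []; _∷_; _++_; map; concatMap; allFin; foldr; filterᵇ)
import Data.List as List
import Data.List.Properties as ListP
import Data.Nat as ℕ
open import Data.Nat using (zero; suc; _<_; z≤n; s≤s; _!)
import Data.Nat.DivMod as DM
open import Data.Nat.ListAction using () renaming (sum to sumℕ)
import Data.Nat.Properties as ℕP
import Data.Nat.Solver as ℕS
open import Data.Product using (Σ; ∃; _,_; proj₁; proj₂)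
open import Data.Rational using (ℚ; 0ℚ; 1ℚ; _+_; _*_; -_; 1/_)
import Data.Rational as ℚ
import Data.Rational.Properties as ℚP
import Data.Rational.Unnormalised as ℚᵘ
import Data.Rational.Unnormalised.Properties as ℚᵘP
import Data.Rational.Solver as ℚS
open import Data.Vec using (Vec; []; _∷_; lookup; tabulate; updateAt)
import Data.Vec as Vec
import Data.Vec.Properties as VecP
open import Function using (_∘_; id)
open import Function.Definitions using (Injective)
open import Relation.Binary using (tri<; tri≈; tri>)
open import Relation.Binary.PropositionalEquality
  using (_≡_; _≢_; _≗_; refl; sym; trans; cong; cong₂; subst; module ≡-Reasoning)
open import Relation.Nullary using (Dec; yes; no; does; contradiction)
open import Relation.Nullary.Decidable using (dec-true; dec-false; decidable-stable; ¬?; _×-dec_)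
open ≡-Reasoning

open SemiringSum (CommutativeRing.semiring ℚP.+-*-commutativeRing)
  using (sum; sum-cong-≗; sum-permute; ∑-comm; ∑-distrib-+; *-distribˡ-sum; sum-replicate-zero)
module ℕSum = SemiringSum ℕP.+-*-semiring
open MonoidSum ℚP.*-1-commutativeMonoid
  using ()
  renaming (sum to prod; sum-cong-≗ to prod-cong; sum-permute to prod-permute; ∑-distrib-+ to prod-distrib-*)

-- Alternation says less here than for polynomials in x alone. A permutation moves the label i of
-- y_i along with x, so it separates only the exponents of the x_j with j ≠ i and leaves that of x_i
-- free. If v is the value they miss, comparing degrees gives v = k + (exponent of x_i). At exponent
-- 0 this reads k = v, a number in 0 ... n-1, so negative and large k are excluded by the same step
-- that isolates the orbit. Each remaining case turns on one number. For 1 ≤ k < n a multiple c E_k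
-- Δ_n is subtracted from P to cancel the coefficient at the orbit representative; for E_k Δ_n this
-- is the divided power coefficient of Δ_n at the exponents 0, 1, ..., n-1, which is a sign. For k =
-- 0 the candidate (∑ y_i) Δ_n satisfies every condition in the x-derivatives alone, but ∑ ∂_{y_i}
-- maps it to n Δ_n. E_k Δ_n inherits harmonicity from Δ_n because ∑ ∂_{x_i}^a ∂_{y_i} E_k = ∑
-- ∂_{x_i}^{a+k} on polynomials in x, an operator of positive order since k > 0.

sum-zero : ∀ {n} {f : Fin n → ℚ} → (∀ i → f i ≡ 0ℚ) → sum f ≡ 0ℚ
sum-zero {n} h = trans (sum-cong-≗ h) (sum-replicate-zero n)

prod-one : ∀ {n} {f : Fin n → ℚ} → (∀ i → f i ≡ 1ℚ) → prod f ≡ 1ℚ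
prod-one {zero}  h = refl
prod-one {suc n} h = cong₂ _*_ (h zero) (prod-one (h ∘ suc))

sum-single : ∀ {n} {f : Fin n → ℚ} i → (∀ j → j ≢ i → f j ≡ 0ℚ) → sum f ≡ f i
sum-single {suc n} {f} zero h =
  trans (cong (f zero +_) (sum-zero λ j → h (suc j) λ ())) (ℚP.+-identityʳ _)
sum-single {suc n} {f} (suc i) h =
  trans (cong₂ _+_ (h zero λ ())
                   (sum-single i λ j j≢i → h (suc j) (j≢i ∘ FinP.suc-injective)))
        (ℚP.+-identityˡ _)

sum-pair : ∀ {n} {f : Fin n → ℚ} {i j} → i ≢ j →
  (∀ l → l ≢ i → l ≢ j → f l ≡ 0ℚ) → sum f ≡ f i + f j
sum-pair {_} {f} {zero} {zero} i≢j h = contradiction refl i≢j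
sum-pair {_} {f} {zero} {suc j} i≢j h =
  cong (f zero +_) (sum-single j λ l l≢j → h (suc l) (λ ()) (l≢j ∘ FinP.suc-injective))
sum-pair {_} {f} {suc i} {zero} i≢j h =
  trans (cong (f zero +_) (sum-single i λ l l≢i → h (suc l) (l≢i ∘ FinP.suc-injective) λ ()))
        (ℚP.+-comm (f zero) (f (suc i)))
sum-pair {_} {f} {suc i} {suc j} i≢j h =
  trans (cong₂ _+_ (h zero (λ ()) λ ())
          (sum-pair (i≢j ∘ cong suc)
            λ l l≢i l≢j → h (suc l) (l≢i ∘ FinP.suc-injective) (l≢j ∘ FinP.suc-injective)))
        (ℚP.+-identityˡ _)

sum≢0⇒∃ : ∀ {n} (f : Fin n → ℚ) → sum f ≢ 0ℚ → ∃ λ i → f i ≢ 0ℚ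
sum≢0⇒∃ {n} f s≢0 = FinP.¬∀⟶∃¬ n (λ i → f i ≡ 0ℚ) (λ i → f i ℚP.≟ 0ℚ) (s≢0 ∘ sum-zero)

-- Cancellation in ℚ and the embedding of ℕ

*-cancelˡ-≡ : ∀ {p q r} → p ≢ 0ℚ → p * q ≡ p * r → q ≡ r
*-cancelˡ-≡ {p} {q} {r} p≢0 pq≡pr = trans (sym (div q)) (trans (cong (1/ p *_) pq≡pr) (div r))
  where
  instance _ = ℚ.≢-nonZero p≢0
  div : ∀ s → 1/ p * (p * s) ≡ s
  div s = begin
    1/ p * (p * s)  ≡⟨ ℚP.*-assoc (1/ p) p s ⟨
    1/ p * p * s    ≡⟨ cong (_* s) (ℚP.*-inverseˡ p) ⟩
    1ℚ * s          ≡⟨ ℚP.*-identityˡ s ⟩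
    s               ∎

*-cancelˡ-0 : ∀ {p q} → p ≢ 0ℚ → p * q ≡ 0ℚ → q ≡ 0ℚ
*-cancelˡ-0 {p} p≢0 pq≡0 = *-cancelˡ-≡ p≢0 (trans pq≡0 (sym (ℚP.*-zeroʳ p)))

*-≢0 : ∀ {p q} → p ≢ 0ℚ → q ≢ 0ℚ → p * q ≢ 0ℚ
*-≢0 p≢0 q≢0 = q≢0 ∘ *-cancelˡ-0 p≢0

*-≢0ʳ : ∀ p {q} → p * q ≢ 0ℚ → q ≢ 0ℚ
*-≢0ʳ p pq≢0 q≡0 = pq≢0 (trans (cong (p *_) q≡0) (ℚP.*-zeroʳ p))

p≡-p⇒p≡0 : ∀ {p} → p ≡ - p → p ≡ 0ℚ
p≡-p⇒p≡0 {p} eq = *-cancelˡ-0 {1ℚ + 1ℚ} (λ ()) (begin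
  (1ℚ + 1ℚ) * p    ≡⟨ ℚP.*-distribʳ-+ p 1ℚ 1ℚ ⟩
  1ℚ * p + 1ℚ * p  ≡⟨ cong₂ _+_ (ℚP.*-identityˡ p) (trans (ℚP.*-identityˡ p) eq) ⟩
  p + - p          ≡⟨ ℚP.+-inverseʳ p ⟩
  0ℚ               ∎)

-- The division in `ℕtoℚ` normalises by a gcd and is stuck on a variable. Among unnormalised
-- rationals m/1 is a literal fraction, so the homomorphism laws below become integer identities.
ℕtoℚᵘ : ∀ m → ℚ.toℚᵘ (ℕtoℚ m) ℚᵘ.≃ ℚᵘ.mkℚᵘ (ℤ.+ m) 0
ℕtoℚᵘ m = ℚP.toℚᵘ-fromℚᵘ (ℚᵘ.mkℚᵘ (ℤ.+ m) 0)

ℕtoℚ-* : ∀ m n → ℕtoℚ (m ℕ.* n) ≡ ℕtoℚ m * ℕtoℚ n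
ℕtoℚ-* m n = ℚP.toℚᵘ-injective (ℚᵘP.≃-trans (ℕtoℚᵘ (m ℕ.* n))
  (ℚᵘP.≃-trans (ℚᵘ.*≡* (cong (ℤ._* ℤ.+ 1) (ℤP.pos-* m n)))
  (ℚᵘP.≃-sym (ℚᵘP.≃-trans (ℚP.toℚᵘ-homo-* (ℕtoℚ m) (ℕtoℚ n))
    (ℚᵘP.*-cong (ℕtoℚᵘ m) (ℕtoℚᵘ n))))))

ℕtoℚ-suc : ∀ n → ℕtoℚ (suc n) ≡ 1ℚ + ℕtoℚ n
ℕtoℚ-suc n = ℚP.toℚᵘ-injective (ℚᵘP.≃-trans (ℕtoℚᵘ (suc n))
  (ℚᵘP.≃-trans (ℚᵘ.*≡* (cong (λ z → (ℤ.1ℤ ℤ.+ z) ℤ.* ℤ.1ℤ) (sym (ℤP.*-identityʳ (ℤ.+ n)))))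
  (ℚᵘP.≃-sym (ℚᵘP.≃-trans (ℚP.toℚᵘ-homo-+ 1ℚ (ℕtoℚ n))
    (ℚᵘP.+-cong (ℚᵘP.≃-refl {ℚᵘ.1ℚᵘ}) (ℕtoℚᵘ n))))))

ℕtoℚ≢0 : ∀ n .{{_ : ℕ.NonZero n}} → ℕtoℚ n ≢ 0ℚ
ℕtoℚ≢0 (suc n) eq
  with ℚᵘP.≃-trans (ℚᵘP.≃-sym (ℕtoℚᵘ (suc n))) (ℚᵘP.≃-reflexive (cong ℚ.toℚᵘ eq))
... | ℚᵘ.*≡* ()

-- Signs of permutations

-- The comparison is a number, so that inversion counts become double sums that can be split,
-- multiplied and reindexed.
lt : ∀ {n} → Fin n → Fin n → ℕ
lt i j = if toℕ i ℕ.<ᵇ toℕ j then 1 else 0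

lt-yes : ∀ {n} {i j : Fin n} → i Fin.< j → lt i j ≡ 1
lt-yes {i = i} {j} i<j with toℕ i ℕ.<ᵇ toℕ j | ℕP.<⇒<ᵇ i<j
... | true | _ = refl

lt-no : ∀ {n} {i j : Fin n} → ¬ (i Fin.< j) → lt i j ≡ 0
lt-no {i = i} {j} i≮j with toℕ i ℕ.<ᵇ toℕ j | ℕP.<ᵇ⇒< (toℕ i) (toℕ j)
... | true  | f = contradiction (f _) i≮j
... | false | _ = refl

lt-+ : ∀ {n} {i j : Fin n} → i ≢ j → lt i j ℕ.+ lt j i ≡ 1
lt-+ {i = i} {j} i≢j with FinP.<-cmp i j
... | tri< i<j _ j≮i = cong₂ ℕ._+_ (lt-yes i<j) (lt-no j≮i)
... | tri≈ _ i≡j _   = contradiction i≡j i≢j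
... | tri> i≮j _ j<i = cong₂ ℕ._+_ (lt-no i≮j) (lt-yes j<i)

inv : ∀ {n} → (Fin n → Fin n) → Fin n → Fin n → ℕ
inv f i j = lt i j ℕ.* lt (f j) (f i)

sumℕ-allFin : ∀ {n} (f : Fin n → ℕ) → sumℕ (map f (allFin n)) ≡ ℕSum.sum f
sumℕ-allFin {n} f = trans (cong sumℕ (ListP.map-tabulate id f)) (go f)
  where
  go : ∀ {m} (g : Fin m → ℕ) → sumℕ (List.tabulate g) ≡ ℕSum.sum g
  go {zero}  g = refl
  go {suc m} g = cong (g zero ℕ.+_) (go (g ∘ suc))

inversions-inv : ∀ {n} (f : Fin n → Fin n) →
  inversions f ≡ ℕSum.sum λ i → ℕSum.sum λ j → inv f i j
inversions-inv {n} f = trans (sumℕ-allFin (λ i → sumℕ (map (invᵇ i) (allFin n))))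
  (ℕSum.sum-cong-≗ λ i → trans (sumℕ-allFin (invᵇ i)) (ℕSum.sum-cong-≗ λ j →
    if-∧ (toℕ i ℕ.<ᵇ toℕ j) (toℕ (f j) ℕ.<ᵇ toℕ (f i))))
  where
  invᵇ : Fin n → Fin n → ℕ
  invᵇ i j = if (toℕ i ℕ.<ᵇ toℕ j) ∧ (toℕ (f j) ℕ.<ᵇ toℕ (f i)) then 1 else 0
  if-∧ : ∀ a b → (if a ∧ b then 1 else 0) ≡ (if a then 1 else 0) ℕ.* (if b then 1 else 0)
  if-∧ true  true  = refl
  if-∧ true  false = refl
  if-∧ false b     = refl

negOnePow-+ : ∀ a b → negOnePow (a ℕ.+ b) ≡ negOnePow a * negOnePow b
negOnePow-+ zero    b = sym (ℚP.*-identityˡ _)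
negOnePow-+ (suc a) b =
  trans (cong -_ (negOnePow-+ a b)) (ℚP.neg-distribˡ-* (negOnePow a) (negOnePow b))

negOnePow² : ∀ a → negOnePow a * negOnePow a ≡ 1ℚ
negOnePow² zero    = refl
negOnePow² (suc a) = begin
  - p * - p    ≡⟨ ℚP.neg-distribˡ-* p (- p) ⟨
  - (p * - p)  ≡⟨ cong -_ (ℚP.neg-distribʳ-* p p) ⟨
  - - (p * p)  ≡⟨ cong (-_ ∘ -_) (negOnePow² a) ⟩
  1ℚ           ∎
  where p = negOnePow a

negOnePow-2* : ∀ c → negOnePow (2 ℕ.* c) ≡ 1ℚ
negOnePow-2* c = trans (cong negOnePow (cong (c ℕ.+_) (ℕP.+-identityʳ c)))
                       (trans (negOnePow-+ c c) (negOnePow² c))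

-- Whether the unordered pair {a , b} is inverted by f.
flips : ∀ {n} → (Fin n → Fin n) → Fin n → Fin n → ℕ
flips f a b = inv f a b ℕ.+ inv f b a

flips-comm : ∀ {n} (f : Fin n → Fin n) a b → flips f a b ≡ flips f b a
flips-comm f a b = ℕP.+-comm (inv f a b) (inv f b a)

flips-diag : ∀ {n} (f : Fin n → Fin n) a → flips f a a ≡ 0
flips-diag f a rewrite lt-no {i = a} {a} (ℕP.<-irrefl refl) = refl

∑∑ : ∀ {n} → (Fin n → Fin n → ℕ) → ℕ
∑∑ X = ℕSum.sum λ i → ℕSum.sum λ j → X i j

∑∑-cong : ∀ {n} {X Y : Fin n → Fin n → ℕ} → (∀ i j → X i j ≡ Y i j) → ∑∑ X ≡ ∑∑ Y
∑∑-cong h = ℕSum.sum-cong-≗ λ i → ℕSum.sum-cong-≗ λ j → h i j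

∑∑-+ : ∀ {n} (X Y : Fin n → Fin n → ℕ) → ∑∑ (λ i j → X i j ℕ.+ Y i j) ≡ ∑∑ X ℕ.+ ∑∑ Y
∑∑-+ X Y = trans (ℕSum.sum-cong-≗ λ i → ℕSum.∑-distrib-+ (X i) (Y i)) (ℕSum.∑-distrib-+ (λ i → ℕSum.sum (X i)) (λ i → ℕSum.sum (Y i)))

∑∑-* : ∀ {n} c (X : Fin n → Fin n → ℕ) → ∑∑ (λ i j → c ℕ.* X i j) ≡ c ℕ.* ∑∑ X
∑∑-* c X = sym (trans (ℕSum.*-distribˡ-sum c λ i → ℕSum.sum (X i))
                      (ℕSum.sum-cong-≗ λ i → ℕSum.*-distribˡ-sum c (X i)))

-- A pair of distinct indices is counted once under the restriction i < j and twice in the full sum.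
-- The full sum, unlike the restricted one, can be reindexed by a permutation.
2∑∑-lt : ∀ {n} (X : Fin n → Fin n → ℕ) → (∀ i j → X i j ≡ X j i) → (∀ i → X i i ≡ 0) →
  2 ℕ.* ∑∑ (λ i j → lt i j ℕ.* X i j) ≡ ∑∑ X
2∑∑-lt {n} X X-comm X-diag = begin
  A ℕ.+ (A ℕ.+ 0)                                          ≡⟨ cong (A ℕ.+_) (ℕP.+-identityʳ A) ⟩
  A ℕ.+ A                                                  ≡⟨ cong (A ℕ.+_) (ℕSum.∑-comm λ i j → lt i j ℕ.* X i j) ⟩
  A ℕ.+ ∑∑ (λ i j → lt j i ℕ.* X j i)                      ≡⟨ ∑∑-+ (λ i j → lt i j ℕ.* X i j) (λ i j → lt j i ℕ.* X j i) ⟨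
  ∑∑ (λ i j → lt i j ℕ.* X i j ℕ.+ lt j i ℕ.* X j i)       ≡⟨ ∑∑-cong pointwise ⟩
  ∑∑ X                                                     ∎
  where
  A = ∑∑ (λ i j → lt i j ℕ.* X i j)
  pointwise : ∀ i j → lt i j ℕ.* X i j ℕ.+ lt j i ℕ.* X j i ≡ X i j
  pointwise i j with i Fin.≟ j
  ... | yes refl rewrite X-diag i | ℕP.*-zeroʳ (lt i i) = refl
  ... | no i≢j = begin
    lt i j ℕ.* X i j ℕ.+ lt j i ℕ.* X j i  ≡⟨ cong (λ x → lt i j ℕ.* X i j ℕ.+ lt j i ℕ.* x) (X-comm j i) ⟩
    lt i j ℕ.* X i j ℕ.+ lt j i ℕ.* X i j  ≡⟨ ℕP.*-distribʳ-+ (X i j) (lt i j) (lt j i) ⟨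
    (lt i j ℕ.+ lt j i) ℕ.* X i j          ≡⟨ cong (ℕ._* X i j) (lt-+ i≢j) ⟩
    1 ℕ.* X i j                            ≡⟨ ℕP.*-identityˡ _ ⟩
    X i j                                  ∎

∑∑-permute : ∀ {n} (X : Fin n → Fin n → ℕ) (π : Permutation′ n) →
  ∑∑ X ≡ ∑∑ (λ i j → X (π ⟨$⟩ʳ i) (π ⟨$⟩ʳ j))
∑∑-permute X π =
  trans (ℕSum.sum-permute (λ i → ℕSum.sum (X i)) π) (ℕSum.sum-cong-≗ λ i → ℕSum.sum-permute (X (π ⟨$⟩ʳ i)) π)

permutation-injective : ∀ {n} (π : Permutation′ n) → Injective _≡_ _≡_ (π ⟨$⟩ʳ_)
permutation-injective π {a} {b} eq =
  trans (sym (inverseˡ π)) (trans (cong (π ⟨$⟩ˡ_) eq) (inverseˡ π))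

-- A pair i < j is inverted by f ∘ π exactly when one of the following holds, but not both:
-- π inverts it; f inverts the unordered pair {π i , π j}.
inv-∘ : ∀ {n} (f : Fin n → Fin n) → Injective _≡_ _≡_ f → (π : Permutation′ n) → ∀ i j →
  let a = π ⟨$⟩ʳ i; b = π ⟨$⟩ʳ j in
  lt i j ℕ.* lt (f b) (f a) ℕ.+ 2 ℕ.* (lt i j ℕ.* (lt b a ℕ.* flips f a b))
    ≡ lt i j ℕ.* lt b a ℕ.+ lt i j ℕ.* flips f a b
inv-∘ f f-inj π i j with i Fin.≟ j
... | yes refl rewrite lt-no {i = i} {i} (ℕP.<-irrefl refl) = refl
... | no i≢j = begin
  l ℕ.* lt (f b) (f a) ℕ.+ 2 ℕ.* (l ℕ.* (lt b a ℕ.* flips f a b))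
    ≡⟨ solve 4 (λ x y z w → x :* y :+ con 2 :* (x :* (z :* w)) := x :* (y :+ con 2 :* (z :* w)))
         refl l (lt (f b) (f a)) (lt b a) (flips f a b) ⟩
  l ℕ.* (lt (f b) (f a) ℕ.+ 2 ℕ.* (lt b a ℕ.* flips f a b))
    ≡⟨ cong (l ℕ.*_) xor ⟩
  l ℕ.* (lt b a ℕ.+ flips f a b)
    ≡⟨ ℕP.*-distribˡ-+ l (lt b a) (flips f a b) ⟩
  l ℕ.* lt b a ℕ.+ l ℕ.* flips f a b ∎
  where
  open ℕS.+-*-Solver
  a = π ⟨$⟩ʳ i
  b = π ⟨$⟩ʳ j
  l = lt i j
  a≢b : a ≢ b
  a≢b = i≢j ∘ permutation-injective π
  xor : lt (f b) (f a) ℕ.+ 2 ℕ.* (lt b a ℕ.* flips f a b) ≡ lt b a ℕ.+ flips f a b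
  xor with FinP.<-cmp a b
  ... | tri≈ _ a≡b _ = contradiction a≡b a≢b
  ... | tri< a<b _ b≮a rewrite lt-yes a<b | lt-no b≮a =
    solve 1 (λ x → x :+ con 0 := x :+ con 0 :+ con 0) refl (lt (f b) (f a))
  ... | tri> a≮b _ b<a rewrite lt-yes b<a | lt-no a≮b = begin
    x ℕ.+ 2 ℕ.* (1 ℕ.* (1 ℕ.* y))   ≡⟨ solve 2 (λ x y → x :+ con 2 :* (con 1 :* (con 1 :* y)) := (x :+ y) :+ con 1 :* y) refl x y ⟩
    (x ℕ.+ y) ℕ.+ 1 ℕ.* y           ≡⟨ cong (ℕ._+ 1 ℕ.* y) (lt-+ (a≢b ∘ sym ∘ f-inj)) ⟩
    1 ℕ.+ 1 ℕ.* y                   ∎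
    where
    x = lt (f b) (f a)
    y = lt (f a) (f b)

-- Summing `inv-∘` over all i and j shows that the inversions of f ∘ π, plus an even number, equal
-- those of f plus those of π; the even number disappears in the sign.
sgnFun-∘ : ∀ {n} (f : Fin n → Fin n) → Injective _≡_ _≡_ f → (π : Permutation′ n) →
  sgnFun (f ∘ (π ⟨$⟩ʳ_)) ≡ sgnFun f * sgn π
sgnFun-∘ f f-inj π = begin
  negOnePow (inversions (f ∘ π′))                ≡⟨ ℚP.*-identityʳ _ ⟨
  negOnePow (inversions (f ∘ π′)) * 1ℚ           ≡⟨ cong (negOnePow (inversions (f ∘ π′)) *_) (negOnePow-2* c) ⟨
  negOnePow (inversions (f ∘ π′)) * negOnePow (2 ℕ.* c) ≡⟨ negOnePow-+ (inversions (f ∘ π′)) (2 ℕ.* c) ⟨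
  negOnePow (inversions (f ∘ π′) ℕ.+ 2 ℕ.* c)    ≡⟨ cong negOnePow count ⟩
  negOnePow (inversions f ℕ.+ inversions π′)     ≡⟨ negOnePow-+ (inversions f) (inversions π′) ⟩
  sgnFun f * sgn π                               ∎
  where
  π′ = π ⟨$⟩ʳ_
  X = λ i j → flips f (π′ i) (π′ j)
  Y = λ i j → lt i j ℕ.* (lt (π′ j) (π′ i) ℕ.* X i j)
  Z = λ i j → lt i j ℕ.* X i j
  c = ∑∑ Y
  -- The condition i < j is not preserved by π. After doubling it is gone, π can be removed by
  -- reindexing, and the factor 2 is cancelled.
  flipped : ∑∑ Z ≡ inversions f
  flipped = ℕP.*-cancelˡ-≡ _ _ 2 (begin
    2 ℕ.* ∑∑ Z                           ≡⟨ 2∑∑-lt X (λ i j → flips-comm f (π′ i) (π′ j)) (λ i → flips-diag f (π′ i)) ⟩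
    ∑∑ X                                 ≡⟨ ∑∑-permute (flips f) π ⟨
    ∑∑ (flips f)                         ≡⟨ ∑∑-+ (inv f) (λ i j → inv f j i) ⟩
    ∑∑ (inv f) ℕ.+ ∑∑ (λ i j → inv f j i) ≡⟨ cong (∑∑ (inv f) ℕ.+_) (ℕSum.∑-comm (inv f)) ⟨
    ∑∑ (inv f) ℕ.+ ∑∑ (inv f)            ≡⟨ cong (∑∑ (inv f) ℕ.+_) (ℕP.+-identityʳ (∑∑ (inv f))) ⟨
    2 ℕ.* ∑∑ (inv f)                     ≡⟨ cong (2 ℕ.*_) (inversions-inv f) ⟨
    2 ℕ.* inversions f                   ∎)
  count : inversions (f ∘ π′) ℕ.+ 2 ℕ.* c ≡ inversions f ℕ.+ inversions π′
  count = begin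
    inversions (f ∘ π′) ℕ.+ 2 ℕ.* c
      ≡⟨ cong₂ ℕ._+_ (inversions-inv (f ∘ π′)) (sym (∑∑-* 2 Y)) ⟩
    ∑∑ (inv (f ∘ π′)) ℕ.+ ∑∑ (λ i j → 2 ℕ.* Y i j)
      ≡⟨ ∑∑-+ (inv (f ∘ π′)) (λ i j → 2 ℕ.* Y i j) ⟨
    ∑∑ (λ i j → inv (f ∘ π′) i j ℕ.+ 2 ℕ.* Y i j)
      ≡⟨ ∑∑-cong (inv-∘ f f-inj π) ⟩
    ∑∑ (λ i j → inv π′ i j ℕ.+ Z i j)
      ≡⟨ ∑∑-+ (inv π′) Z ⟩
    ∑∑ (inv π′) ℕ.+ ∑∑ Z
      ≡⟨ cong₂ ℕ._+_ (sym (inversions-inv π′)) flipped ⟩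
    inversions π′ ℕ.+ inversions f
      ≡⟨ ℕP.+-comm (inversions π′) (inversions f) ⟩
    inversions f ℕ.+ inversions π′ ∎

sgnFun-cong : ∀ {n} {f g : Fin n → Fin n} → f ≗ g → sgnFun f ≡ sgnFun g
sgnFun-cong {f = f} {g} f≗g = cong negOnePow
  (trans (inversions-inv f) (trans
    (∑∑-cong λ i j → cong (lt i j ℕ.*_) (cong₂ lt (f≗g j) (f≗g i)))
    (sym (inversions-inv g))))

sgnFun≢0 : ∀ {n} (f : Fin n → Fin n) → sgnFun f ≢ 0ℚ
sgnFun≢0 f eq with trans (sym (negOnePow² (inversions f))) (cong (sgnFun f *_) eq)
... | 1≡ = contradiction (trans 1≡ (ℚP.*-zeroʳ (sgnFun f))) λ ()

swap₀₁ : ∀ {m} → Fin (suc (suc m)) → Fin (suc (suc m))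
swap₀₁ zero          = suc zero
swap₀₁ (suc zero)    = zero
swap₀₁ (suc (suc i)) = suc (suc i)

swap₀₁-involutive : ∀ {m} (i : Fin (suc (suc m))) → swap₀₁ (swap₀₁ i) ≡ i
swap₀₁-involutive zero          = refl
swap₀₁-involutive (suc zero)    = refl
swap₀₁-involutive (suc (suc i)) = refl

swap₀₁ₚ : ∀ {m} → Permutation′ (suc (suc m))
swap₀₁ₚ = permutation swap₀₁ swap₀₁ swap₀₁-involutive swap₀₁-involutive

ℕsum-zero : ∀ {n} {f : Fin n → ℕ} → (∀ i → f i ≡ 0) → ℕSum.sum f ≡ 0
ℕsum-zero {n} h = trans (ℕSum.sum-cong-≗ h) (ℕSum.sum-replicate-zero n)

ℕsum-single : ∀ {n} {f : Fin n → ℕ} i → (∀ j → j ≢ i → f j ≡ 0) → ℕSum.sum f ≡ f i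
ℕsum-single {suc n} {f} zero h =
  trans (cong (f zero ℕ.+_) (ℕsum-zero λ j → h (suc j) λ ())) (ℕP.+-identityʳ _)
ℕsum-single {suc n} {f} (suc i) h = cong₂ ℕ._+_ (h zero λ ())
  (ℕsum-single i λ j j≢i → h (suc j) (j≢i ∘ FinP.suc-injective))

sgn-swap₀₁ : ∀ {m} → sgn (swap₀₁ₚ {m}) ≡ - 1ℚ
sgn-swap₀₁ {m} = cong negOnePow {inversions (swap₀₁ {m})} {1}
  (trans (inversions-inv (swap₀₁ {m})) (cong₂ ℕ._+_
    (cong suc (ℕsum-zero {m} λ j → refl))
    (cong₂ ℕ._+_ (ℕsum-zero {m} λ j → refl) (ℕsum-zero {m} λ i → ℕsum-zero {m} λ j → none i j))))
  where
  none : ∀ i j → inv (swap₀₁ {m}) (suc (suc i)) (suc (suc j)) ≡ 0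
  none i j with FinP.<-cmp i j
  ... | tri< _ _ j≮i = trans (cong (lt i j ℕ.*_) (lt-no j≮i)) (ℕP.*-zeroʳ (lt i j))
  ... | tri≈ i≮j _ _ = cong (ℕ._* lt j i) (lt-no i≮j)
  ... | tri> i≮j _ _ = cong (ℕ._* lt j i) (lt-no i≮j)

transpose-ˡ : ∀ {n} (i j : Fin n) → PC.transpose i j i ≡ j
transpose-ˡ i j rewrite dec-true (i Fin.≟ i) refl = refl

transpose-ʳ : ∀ {n} (i j : Fin n) → PC.transpose i j j ≡ i
transpose-ʳ i j with j Fin.≟ i
... | yes j≡i = j≡i
... | no _ rewrite dec-true (j Fin.≟ j) refl = refl

transpose-≢ : ∀ {n} {i j k : Fin n} → k ≢ i → k ≢ j → PC.transpose i j k ≡ k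
transpose-≢ {i = i} {j} {k} k≢i k≢j
  rewrite dec-false (k Fin.≟ i) k≢i | dec-false (k Fin.≟ j) k≢j = refl

-- All transpositions are conjugate: τ ∘ π = π ∘ `swap₀₁` whenever π sends 0 to i and 1 to j. By
-- multiplicativity it suffices to count the inversions of `swap₀₁`.
sgn-transpose : ∀ {n} {i j : Fin n} → i ≢ j → sgn (Perm.transpose i j) ≡ - 1ℚ
sgn-transpose {suc zero} {zero} {zero} i≢j = contradiction refl i≢j
sgn-transpose {suc (suc m)} {i} {j} i≢j = begin
  sgn τ                       ≡⟨ ℚP.*-identityʳ _ ⟨
  sgn τ * 1ℚ                  ≡⟨ cong (sgn τ *_) (negOnePow² (inversions π′)) ⟨
  sgn τ * (sgn π * sgn π)     ≡⟨ ℚP.*-assoc (sgn τ) (sgn π) (sgn π) ⟨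
  sgn τ * sgn π * sgn π       ≡⟨ cong (_* sgn π) (sgnFun-∘ (τ ⟨$⟩ʳ_) (permutation-injective τ) π) ⟨
  sgnFun ((τ ⟨$⟩ʳ_) ∘ π′) * sgn π   ≡⟨ cong (_* sgn π) (sgnFun-cong conjugate) ⟩
  sgnFun (π′ ∘ swap₀₁) * sgn π      ≡⟨ cong (_* sgn π) (sgnFun-∘ π′ (permutation-injective π) (swap₀₁ₚ {m})) ⟩
  sgn π * sgn (swap₀₁ₚ {m}) * sgn π       ≡⟨ cong (λ s → sgn π * s * sgn π) (sgn-swap₀₁ {m}) ⟩
  sgn π * - 1ℚ * sgn π        ≡⟨ solve 1 (λ x → x :* con (- 1ℚ) :* x := con (- 1ℚ) :* (x :* x)) refl (sgn π) ⟩
  - 1ℚ * (sgn π * sgn π)      ≡⟨ cong (- 1ℚ *_) (negOnePow² (inversions π′)) ⟩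
  - 1ℚ                        ∎
  where
  open ℚS.+-*-Solver
  τ = Perm.transpose i j
  -- The preimage of j under (0 i). Hence (1 k) followed by (0 i) sends 1 to j, and also 0 to i
  -- because k ≠ 0.
  k = PC.transpose i zero j
  k↦j : PC.transpose zero i k ≡ j
  k↦j = PC.transpose-inverse zero i
  k≢0 : zero ≢ k
  k≢0 0≡k = i≢j (trans (sym (transpose-ˡ zero i)) (trans (cong (PC.transpose zero i) 0≡k) k↦j))
  π = Perm.transpose (suc zero) k ∘ₚ Perm.transpose zero i
  π′ = π ⟨$⟩ʳ_
  π0 : π′ zero ≡ i
  π0 = trans (cong (PC.transpose zero i) (transpose-≢ {i = suc zero} (λ ()) k≢0)) (transpose-ˡ zero i)
  π1 : π′ (suc zero) ≡ j
  π1 = trans (cong (PC.transpose zero i) (transpose-ˡ (suc zero) k)) k↦j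
  conjugate : (τ ⟨$⟩ʳ_) ∘ π′ ≗ π′ ∘ swap₀₁
  conjugate zero = trans (cong (τ ⟨$⟩ʳ_) π0) (trans (transpose-ˡ i j) (sym π1))
  conjugate (suc zero) = trans (cong (τ ⟨$⟩ʳ_) π1) (trans (transpose-ʳ i j) (sym π0))
  conjugate (suc (suc x)) = transpose-≢
    (λ eq → contradiction (permutation-injective π {suc (suc x)} {zero} (trans eq (sym π0))) λ ())
    (λ eq → contradiction (permutation-injective π {suc (suc x)} {suc zero} (trans eq (sym π1))) λ ())

-- Divided power coefficients

vec-ext : ∀ {n} {x y : Vec ℕ n} → (∀ j → lookup x j ≡ lookup y j) → x ≡ y
vec-ext {x = x} {y} h = trans (sym (VecP.tabulate∘lookup x))
                              (trans (VecP.tabulate-cong h) (VecP.tabulate∘lookup y))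

inc dec : ∀ {n} → Fin n → ℕ → Vec ℕ n → Vec ℕ n
inc i k x = updateAt x i (ℕ._+ k)
dec i k x = updateAt x i (ℕ._∸ k)

-- `act` reindexes the exponents of a monomial by the inverse of σ; reading off a coefficient of the
-- result therefore composes its exponents with σ itself.
permute : ∀ {n} → Permutation′ n → Vec ℕ n → Vec ℕ n
permute σ x = tabulate λ j → lookup x (σ ⟨$⟩ʳ j)

lookup-permute : ∀ {n} (σ : Permutation′ n) x j → lookup (permute σ x) j ≡ lookup x (σ ⟨$⟩ʳ j)
lookup-permute σ x j = VecP.lookup∘tabulate _ j

-- The value at 0 of the e-th derivative of the monomial of degree f. `w` is the same in several
-- variables.
w₁ : ℕ → ℕ → ℕ
w₁ e f = if does (f ℕ.≟ e) then e ! else 0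

w₁-suc-suc : ∀ e f → w₁ (suc e) (suc f) ≡ suc e ℕ.* w₁ e f
w₁-suc-suc e f with f ℕ.≟ e
... | yes refl rewrite dec-true (suc f ℕ.≟ suc f) refl = refl
... | no f≢e rewrite dec-false (suc f ℕ.≟ suc e) (f≢e ∘ ℕP.suc-injective) = sym (ℕP.*-zeroʳ (suc e))

-- The truncated subtraction does no harm, since at e = 0 the factor e vanishes.
w₁-suc : ∀ e f → w₁ e (suc f) ≡ e ℕ.* w₁ (e ∸ 1) f
w₁-suc zero    f = refl
w₁-suc (suc e) f = w₁-suc-suc e f

w₁-≢ : ∀ {e f} → f ≢ e → w₁ e f ≡ 0
w₁-≢ {e} {f} f≢e rewrite dec-false (f ℕ.≟ e) f≢e = refl

w₁-diag : ∀ e → w₁ e e ≡ e !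
w₁-diag e rewrite dec-true (e ℕ.≟ e) refl = refl

*-w₁-comm : ∀ e f → e ℕ.* w₁ e f ≡ f ℕ.* w₁ e f
*-w₁-comm e f with f ℕ.≟ e
... | yes refl = refl
... | no f≢e rewrite w₁-≢ f≢e = trans (ℕP.*-zeroʳ e) (sym (ℕP.*-zeroʳ f))

-- Both sides are the derivative of order e + a, at 0, of the monomial of degree f. For f < a the
-- truncated exponent f ∸ a is masked by a zero falling factorial.
falling-w₁ : ∀ a e f → falling f a ℕ.* w₁ e (f ∸ a) ≡ w₁ (e ℕ.+ a) f
falling-w₁ zero e f rewrite ℕP.+-identityʳ e = ℕP.+-identityʳ (w₁ e f)
falling-w₁ (suc a) e zero rewrite ℕP.+-suc e a = refl
falling-w₁ (suc a) e (suc f) rewrite ℕP.+-suc e a = begin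
  suc f ℕ.* falling f a ℕ.* w₁ e (f ∸ a)     ≡⟨ ℕP.*-assoc (suc f) (falling f a) _ ⟩
  suc f ℕ.* (falling f a ℕ.* w₁ e (f ∸ a))   ≡⟨ cong (suc f ℕ.*_) (falling-w₁ a e f) ⟩
  suc f ℕ.* w₁ (e ℕ.+ a) f                   ≡⟨ cong (w₁ (e ℕ.+ a) f ℕ.+_) (*-w₁-comm (e ℕ.+ a) f) ⟨
  suc (e ℕ.+ a) ℕ.* w₁ (e ℕ.+ a) f           ≡⟨ w₁-suc-suc (e ℕ.+ a) f ⟨
  w₁ (suc (e ℕ.+ a)) (suc f)                 ∎

w : ∀ {n} → Vec ℕ n → Vec ℕ n → ℚ
w x f = prod λ j → ℕtoℚ (w₁ (lookup x j) (lookup f j))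

w-dec : ∀ {n} (i : Fin n) a x f → ℕtoℚ (falling (lookup f i) a) * w x (dec i a f) ≡ w (inc i a x) f
w-dec zero a (e ∷ x) (f ∷ fs) = trans (sym (ℚP.*-assoc (ℕtoℚ (falling f a)) (ℕtoℚ (w₁ e (f ∸ a))) (w x fs)))
  (cong (_* w x fs) (trans (sym (ℕtoℚ-* (falling f a) (w₁ e (f ∸ a)))) (cong ℕtoℚ (falling-w₁ a e f))))
w-dec (suc i) a (e ∷ x) (f ∷ fs) = begin
  p * (q * w x (dec i a fs))   ≡⟨ ℚP.*-assoc p q _ ⟨
  p * q * w x (dec i a fs)     ≡⟨ cong (_* w x (dec i a fs)) (ℚP.*-comm p q) ⟩
  q * p * w x (dec i a fs)     ≡⟨ ℚP.*-assoc q p _ ⟩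
  q * (p * w x (dec i a fs))   ≡⟨ cong (q *_) (w-dec i a x fs) ⟩
  q * w (inc i a x) fs         ∎
  where
  p = ℕtoℚ (falling (lookup fs i) a)
  q = ℕtoℚ (w₁ e f)

w-suc : ∀ {n} (i : Fin n) x f → w x (updateAt f i suc) ≡ ℕtoℚ (lookup x i) * w (dec i 1 x) f
w-suc zero (e ∷ x) (f ∷ fs) = trans (cong (_* w x fs) (trans (cong ℕtoℚ (w₁-suc e f)) (ℕtoℚ-* e (w₁ (e ∸ 1) f))))
                                    (ℚP.*-assoc (ℕtoℚ e) (ℕtoℚ (w₁ (e ∸ 1) f)) (w x fs))
w-suc (suc i) (e ∷ x) (f ∷ fs) = begin
  q * w x (updateAt fs i suc)      ≡⟨ cong (q *_) (w-suc i x fs) ⟩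
  q * (p * w (dec i 1 x) fs)       ≡⟨ ℚP.*-assoc q p _ ⟨
  q * p * w (dec i 1 x) fs         ≡⟨ cong (_* w (dec i 1 x) fs) (ℚP.*-comm q p) ⟩
  p * q * w (dec i 1 x) fs         ≡⟨ ℚP.*-assoc p q _ ⟩
  p * (q * w (dec i 1 x) fs)       ∎
  where
  p = ℕtoℚ (lookup x i)
  q = ℕtoℚ (w₁ e f)

w-permute : ∀ {n} (σ : Permutation′ n) x f →
  w x (tabulate λ j → lookup f (σ ⟨$⟩ˡ j)) ≡ w (permute σ x) f
w-permute σ x f = trans (prod-permute _ σ) (prod-cong λ j → cong ℕtoℚ (cong₂ w₁
  (sym (lookup-permute σ x j))
  (trans (VecP.lookup∘tabulate _ (σ ⟨$⟩ʳ j)) (cong (lookup f) (inverseˡ σ)))))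

w-≢ : ∀ {n} (x f : Vec ℕ n) → f ≢ x → w x f ≡ 0ℚ
w-≢ []      []       f≢x = contradiction refl f≢x
w-≢ (e ∷ x) (f ∷ fs) f≢x with f ℕ.≟ e
... | no f≢e   = trans (cong (λ m → ℕtoℚ m * w x fs) (w₁-≢ f≢e)) (ℚP.*-zeroˡ (w x fs))
... | yes refl = trans (cong (ℕtoℚ (w₁ f f) *_) (w-≢ x fs (f≢x ∘ cong (f ∷_)))) (ℚP.*-zeroʳ (ℕtoℚ (w₁ f f)))

w-diag≢0 : ∀ {n} (x : Vec ℕ n) → w x x ≢ 0ℚ
w-diag≢0 []      = λ ()
w-diag≢0 (e ∷ x) = *-≢0 (subst (λ m → ℕtoℚ m ≢ 0ℚ) (sym (w₁-diag e)) (ℕtoℚ≢0 (e !) {{e ℕP.!≢0}}))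
                        (w-diag≢0 x)

-- The linear functional with value φ on monomials. Unlike `coeff` it does not branch on equality of
-- monomials, so each operation on formal sums can be checked one term at a time.
pair : ∀ {n} → Poly n → (Mono n → ℚ) → ℚ
pair []            φ = 0ℚ
pair ((c , m) ∷ P) φ = c * φ m + pair P φ

sumL : ∀ {A : Set} → (A → ℚ) → List A → ℚ
sumL g []       = 0ℚ
sumL g (x ∷ xs) = g x + sumL g xs

sumL-allFin : ∀ {n} (f : Fin n → ℚ) → sumL f (allFin n) ≡ sum f
sumL-allFin {n} f = go id
  where
  go : ∀ {m} (h : Fin m → Fin n) → sumL f (List.tabulate h) ≡ sum (f ∘ h)
  go {zero}  h = refl
  go {suc m} h = cong (f (h zero) +_) (go (h ∘ suc))

pair-++ : ∀ {n} (P Q : Poly n) φ → pair (P ++ Q) φ ≡ pair P φ + pair Q φ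
pair-++ []            Q φ = sym (ℚP.+-identityˡ _)
pair-++ ((c , m) ∷ P) Q φ =
  trans (cong (c * φ m +_) (pair-++ P Q φ)) (sym (ℚP.+-assoc (c * φ m) (pair P φ) (pair Q φ)))

pair-sumP : ∀ {n} {A : Set} (G : A → Poly n) L φ →
  pair (sumP (map G L)) φ ≡ sumL (λ v → pair (G v) φ) L
pair-sumP G []      φ = refl
pair-sumP G (v ∷ L) φ =
  trans (pair-++ (G v) (sumP (map G L)) φ) (cong (pair (G v) φ +_) (pair-sumP G L φ))

pair-· : ∀ {n} c (P : Poly n) φ → pair (c · P) φ ≡ c * pair P φ
pair-· c []            φ = sym (ℚP.*-zeroʳ c)
pair-· c ((d , m) ∷ P) φ =
  trans (cong₂ _+_ (ℚP.*-assoc c d (φ m)) (pair-· c P φ)) (sym (ℚP.*-distribˡ-+ c (d * φ m) (pair P φ)))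

-- The coefficient of x^e y^f / (e! f!).  On these, ∂ acts as a shift of the exponents.
dcoeff : ∀ {n} → Poly n → Vec ℕ n → Vec ℕ n → ℚ
dcoeff P x y = pair P λ (f , g) → w x f * w y g

dcoeff-∂ : ∀ {n} (i : Fin n) a b P x y → dcoeff (∂ i a b P) x y ≡ dcoeff P (inc i a x) (inc i b y)
dcoeff-∂ i a b []                  x y = refl
dcoeff-∂ i a b ((c , (f , g)) ∷ P) x y = cong₂ _+_ (begin
  c * p * q * (w x (dec i a f) * w y (dec i b g))
    ≡⟨ solve 5 (λ c p q u v → c :* p :* q :* (u :* v) := c :* ((p :* u) :* (q :* v))) refl
         c p q (w x (dec i a f)) (w y (dec i b g)) ⟩
  c * (p * w x (dec i a f) * (q * w y (dec i b g)))
    ≡⟨ cong₂ (λ u v → c * (u * v)) (w-dec i a x f) (w-dec i b y g) ⟩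
  c * (w (inc i a x) f * w (inc i b y) g) ∎)
  (dcoeff-∂ i a b P x y)
  where
  open ℚS.+-*-Solver
  p = ℕtoℚ (falling (lookup f i) a)
  q = ℕtoℚ (falling (lookup g i) b)

dcoeff-mulY : ∀ {n} (i : Fin n) P x y →
  dcoeff (mulY i P) x y ≡ ℕtoℚ (lookup y i) * dcoeff P x (dec i 1 y)
dcoeff-mulY i []                  x y = sym (ℚP.*-zeroʳ (ℕtoℚ (lookup y i)))
dcoeff-mulY i ((c , (f , g)) ∷ P) x y = trans (cong₂ _+_ (begin
  c * (w x f * w y (updateAt g i suc))     ≡⟨ cong (λ v → c * (w x f * v)) (w-suc i y g) ⟩
  c * (w x f * (p * w (dec i 1 y) g))
    ≡⟨ solve 4 (λ c p u v → c :* (u :* (p :* v)) := p :* (c :* (u :* v))) refl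
         c p (w x f) (w (dec i 1 y) g) ⟩
  p * (c * (w x f * w (dec i 1 y) g))      ∎)
  (dcoeff-mulY i P x y)) (sym (ℚP.*-distribˡ-+ p _ (dcoeff P x (dec i 1 y))))
  where
  open ℚS.+-*-Solver
  p = ℕtoℚ (lookup y i)

dcoeff-act : ∀ {n} (σ : Permutation′ n) P x y →
  dcoeff (act σ P) x y ≡ dcoeff P (permute σ x) (permute σ y)
dcoeff-act σ []                  x y = refl
dcoeff-act σ ((c , (f , g)) ∷ P) x y =
  cong₂ (λ u v → c * u + v) (cong₂ _*_ (w-permute σ x f) (w-permute σ y g)) (dcoeff-act σ P x y)

dcoeff-sumP : ∀ {n m} (G : Fin m → Poly n) x y →
  dcoeff (sumP (map G (allFin m))) x y ≡ sum λ i → dcoeff (G i) x y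
dcoeff-sumP {m = m} G x y = trans (pair-sumP G (allFin m) _) (sumL-allFin λ i → dcoeff (G i) x y)

-- Terms with another monomial have weight 0 and those with this one have weight x! y!. As this
-- weight is nonzero, `≈` amounts to equality of all divided power coefficients.
dcoeff-coeff : ∀ {n} (P : Poly n) x y → dcoeff P x y ≡ coeff P (x , y) * (w x x * w y y)
dcoeff-coeff []                  x y = sym (ℚP.*-zeroˡ (w x x * w y y))
dcoeff-coeff ((c , (f , g)) ∷ P) x y = trans
  (cong (c * (w x f * w y g) +_) (dcoeff-coeff P x y)) (go ((f , g) ≟M (x , y)))
  where
  k = coeff P (x , y)
  d = w x x * w y y
  other : (f , g) ≢ (x , y) → Dec (f ≡ x) → w x f * w y g ≡ 0ℚ
  other fg≢xy (no f≢x)   = trans (cong (_* w y g) (w-≢ x f f≢x)) (ℚP.*-zeroˡ (w y g))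
  other fg≢xy (yes refl) =
    trans (cong (w x f *_) (w-≢ y g (fg≢xy ∘ cong (x ,_)))) (ℚP.*-zeroʳ (w x f))
  go : (dec : Dec ((f , g) ≡ (x , y))) →
    c * (w x f * w y g) + k * d ≡ (if does dec then c + k else k) * d
  go (yes refl)  = sym (ℚP.*-distribʳ-+ d c k)
  go (no fg≢xy) = begin
    c * (w x f * w y g) + k * d   ≡⟨ cong (λ u → c * u + k * d) (other fg≢xy (VecP.≡-dec ℕ._≟_ f x)) ⟩
    c * 0ℚ + k * d                ≡⟨ cong (_+ k * d) (ℚP.*-zeroʳ c) ⟩
    0ℚ + k * d                    ≡⟨ ℚP.+-identityˡ (k * d) ⟩
    k * d                         ∎

factor≢0 : ∀ {n} (x y : Vec ℕ n) → w x x * w y y ≢ 0ℚ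
factor≢0 x y = *-≢0 (w-diag≢0 x) (w-diag≢0 y)

≈⇒dcoeff : ∀ {n} (P Q : Poly n) → P ≈ Q → ∀ x y → dcoeff P x y ≡ dcoeff Q x y
≈⇒dcoeff P Q P≈Q x y = trans (dcoeff-coeff P x y)
  (trans (cong (_* (w x x * w y y)) (P≈Q (x , y))) (sym (dcoeff-coeff Q x y)))

dcoeff⇒≈ : ∀ {n} (P Q : Poly n) → (∀ x y → dcoeff P x y ≡ dcoeff Q x y) → P ≈ Q
dcoeff⇒≈ P Q h (x , y) = *-cancelˡ-≡ (factor≢0 x y) (begin
  d * coeff P (x , y)   ≡⟨ ℚP.*-comm d _ ⟩
  coeff P (x , y) * d   ≡⟨ dcoeff-coeff P x y ⟨
  dcoeff P x y          ≡⟨ h x y ⟩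
  dcoeff Q x y          ≡⟨ dcoeff-coeff Q x y ⟩
  coeff Q (x , y) * d   ≡⟨ ℚP.*-comm _ d ⟩
  d * coeff Q (x , y)   ∎)
  where d = w x x * w y y

dcoeff≢0⇒coeff≢0 : ∀ {n} (P : Poly n) x y → dcoeff P x y ≢ 0ℚ → coeff P (x , y) ≢ 0ℚ
dcoeff≢0⇒coeff≢0 P x y d≢0 c≡0 = d≢0 (trans (dcoeff-coeff P x y)
  (trans (cong (_* (w x x * w y y)) c≡0) (ℚP.*-zeroˡ (w x x * w y y))))

coeff≢0⇒dcoeff≢0 : ∀ {n} (P : Poly n) x y → coeff P (x , y) ≢ 0ℚ → dcoeff P x y ≢ 0ℚ
coeff≢0⇒dcoeff≢0 P x y c≢0 d≡0 = *-≢0 c≢0 (factor≢0 x y) (trans (sym (dcoeff-coeff P x y)) d≡0)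

-- The Vandermonde determinant

sumL-++ : ∀ {A : Set} (g : A → ℚ) xs ys → sumL g (xs ++ ys) ≡ sumL g xs + sumL g ys
sumL-++ g []       ys = sym (ℚP.+-identityˡ _)
sumL-++ g (x ∷ xs) ys =
  trans (cong (g x +_) (sumL-++ g xs ys)) (sym (ℚP.+-assoc (g x) (sumL g xs) (sumL g ys)))

sumL-map : ∀ {A B : Set} (g : B → ℚ) (h : A → B) xs → sumL g (map h xs) ≡ sumL (g ∘ h) xs
sumL-map g h []       = refl
sumL-map g h (x ∷ xs) = cong (g (h x) +_) (sumL-map g h xs)

sumL-concatMap : ∀ {A B : Set} (g : B → ℚ) (F : A → List B) xs →
  sumL g (concatMap F xs) ≡ sumL (λ x → sumL g (F x)) xs
sumL-concatMap g F []       = refl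
sumL-concatMap g F (x ∷ xs) =
  trans (sumL-++ g (F x) (concatMap F xs)) (cong (sumL g (F x) +_) (sumL-concatMap g F xs))

sumL-cong : ∀ {A : Set} {f g : A → ℚ} → (∀ x → f x ≡ g x) → ∀ xs → sumL f xs ≡ sumL g xs
sumL-cong h []       = refl
sumL-cong h (x ∷ xs) = cong₂ _+_ (h x) (sumL-cong h xs)

sumL-filterᵇ : ∀ {A : Set} (g : A → ℚ) (p : A → Bool) xs →
  sumL g (filterᵇ p xs) ≡ sumL (λ x → if p x then g x else 0ℚ) xs
sumL-filterᵇ g p []       = refl
sumL-filterᵇ g p (x ∷ xs) with p x
... | true  = cong (g x +_) (sumL-filterᵇ g p xs)
... | false = trans (sumL-filterᵇ g p xs) (sym (ℚP.+-identityˡ _))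

sumL≢0⇒∃ : ∀ {A : Set} (g : A → ℚ) xs → sumL g xs ≢ 0ℚ → ∃ λ x → g x ≢ 0ℚ
sumL≢0⇒∃ g []       s≢0 = contradiction refl s≢0
sumL≢0⇒∃ g (x ∷ xs) s≢0 with g x ℚP.≟ 0ℚ
... | no gx≢0  = x , gx≢0
... | yes gx≡0 = sumL≢0⇒∃ g xs λ eq → s≢0 (cong₂ _+_ gx≡0 eq)

sumL-allVecs : ∀ {n m} (g : Vec (Fin n) m → ℚ) u → (∀ v → v ≢ u → g v ≡ 0ℚ) →
  sumL g (allVecs m) ≡ g u
sumL-allVecs g [] h = ℚP.+-identityʳ (g [])
sumL-allVecs {n} {suc m} g (a ∷ u) h = begin
  sumL g (allVecs (suc m))                            ≡⟨ sumL-concatMap g (λ v → map (_∷ v) (allFin n)) (allVecs m) ⟩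
  sumL (λ v → sumL g (map (_∷ v) (allFin n))) (allVecs m) ≡⟨ sumL-cong inner (allVecs m) ⟩
  sumL (λ v → sum λ b → g (b ∷ v)) (allVecs m)        ≡⟨ sumL-allVecs _ u (λ v v≢u → sum-zero λ b → h (b ∷ v) (v≢u ∘ VecP.∷-injectiveʳ)) ⟩
  sum (λ b → g (b ∷ u))                               ≡⟨ sum-single a (λ b b≢a → h (b ∷ u) (b≢a ∘ VecP.∷-injectiveˡ)) ⟩
  g (a ∷ u)                                           ∎
  where
  inner : ∀ v → sumL g (map (_∷ v) (allFin n)) ≡ sum λ b → g (b ∷ v)
  inner v = trans (sumL-map g (_∷ v) (allFin n)) (sumL-allFin λ b → g (b ∷ v))

andL-allFin⁻ : ∀ {n} (p : Fin n → Bool) → andL (map p (allFin n)) ≡ true → ∀ i → p i ≡ true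
andL-allFin⁻ {n} p eq = go p (trans (cong andL (sym (ListP.map-tabulate id p))) eq)
  where
  go : ∀ {m} (q : Fin m → Bool) → andL (List.tabulate q) ≡ true → ∀ i → q i ≡ true
  go {suc m} q eq i with q zero in q0
  go {suc m} q eq zero    | true = q0
  go {suc m} q eq (suc i) | true = go (q ∘ suc) eq i

andL-allFin⁺ : ∀ {n} (p : Fin n → Bool) → (∀ i → p i ≡ true) → andL (map p (allFin n)) ≡ true
andL-allFin⁺ {n} p h = trans (cong andL (ListP.map-tabulate id p)) (go p h)
  where
  go : ∀ {m} (q : Fin m → Bool) → (∀ i → q i ≡ true) → andL (List.tabulate q) ≡ true
  go {zero}  q h = refl
  go {suc m} q h rewrite h zero = go (q ∘ suc) (h ∘ suc)

distinctᵇ : ∀ {n} → Vec (Fin n) n → Fin n → Fin n → Bool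
distinctᵇ v i j = if does (i Fin.≟ j) then true else not (does (lookup v i Fin.≟ lookup v j))

injectiveᵇ⁻ : ∀ {n} (v : Vec (Fin n) n) → injectiveᵇ v ≡ true → Injective _≡_ _≡_ (lookup v)
injectiveᵇ⁻ {n} v eq {a} {b} va≡vb with a Fin.≟ b
... | yes a≡b = a≡b
... | no a≢b  = contradiction
  (trans (sym distinct-ab) (andL-allFin⁻ (distinctᵇ v a)
    (andL-allFin⁻ (λ i → andL (map (distinctᵇ v i) (allFin n))) eq a) b))
  λ ()
  where
  distinct-ab : distinctᵇ v a b ≡ false
  distinct-ab rewrite dec-false (a Fin.≟ b) a≢b | dec-true (lookup v a Fin.≟ lookup v b) va≡vb = refl

injectiveᵇ⁺ : ∀ {n} (v : Vec (Fin n) n) → Injective _≡_ _≡_ (lookup v) → injectiveᵇ v ≡ true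
injectiveᵇ⁺ {n} v v-inj = andL-allFin⁺ _ λ a → andL-allFin⁺ (distinctᵇ v a) λ b → distinct a b
  where
  distinct : ∀ a b → distinctᵇ v a b ≡ true
  distinct a b with a Fin.≟ b
  ... | yes _  = refl
  ... | no a≢b rewrite dec-false (lookup v a Fin.≟ lookup v b) (a≢b ∘ v-inj) = refl

zeros : ∀ {n} → Vec ℕ n
zeros {n} = Vec.replicate n 0

1/_! : ℕ → ℚ
1/ m ! = ((ℤ.+ 1) ℚ./ (m !)) {{m ℕP.!≢0}}

1/!*! : ∀ m → 1/ m ! * ℕtoℚ (m !) ≡ 1ℚ
1/!*! m = go (m !) {{m ℕP.!≢0}}
  where
  go : ∀ k .{{_ : ℕ.NonZero k}} → ((ℤ.+ 1) ℚ./ k) * ℕtoℚ k ≡ 1ℚ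
  go (suc k) = ℚP.toℚᵘ-injective (ℚᵘP.≃-trans (ℚP.toℚᵘ-homo-* ((ℤ.+ 1) ℚ./ suc k) (ℕtoℚ (suc k)))
    (ℚᵘP.≃-trans (ℚᵘP.*-cong (ℚP.toℚᵘ-fromℚᵘ (ℚᵘ.mkℚᵘ (ℤ.+ 1) k)) (ℕtoℚᵘ (suc k)))
      (ℚᵘ.*≡* (trans (ℤP.*-identityʳ _) (sym (trans (ℤP.*-identityˡ _) (trans (ℤP.*-comm (ℤ.+ suc k) (ℤ.+ 1)) refl)))))))

module _ {n : ℕ} (g : Fin n → ℕ) where

  monomial : Poly n
  monomial = prodP (map (λ i → xPowFact i (g i)) (allFin n))

  private
    single : Fin n → Vec ℕ n
    single i = updateAt zeros i λ _ → g i

    single-≡ : ∀ i → lookup (single i) i ≡ g i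
    single-≡ i = VecP.lookup∘updateAt i zeros

    single-≢ : ∀ {i j} → j ≢ i → lookup (single i) j ≡ 0
    single-≢ {i} {j} j≢i = trans (VecP.lookup∘updateAt′ j i j≢i zeros) (VecP.lookup-replicate j 0)

    C : List (Fin n) → ℚ
    C = foldr (λ i c → 1/ g i ! * c) 1ℚ

    X Y : List (Fin n) → Vec ℕ n
    X = foldr (λ i x → Vec.zipWith ℕ._+_ (single i) x) zeros
    Y = foldr (λ i y → Vec.zipWith ℕ._+_ zeros y) zeros

    prodP-singletons : ∀ L → prodP (map (λ i → xPowFact i (g i)) L) ≡ (C L , (X L , Y L)) ∷ []
    prodP-singletons []      = refl
    prodP-singletons (i ∷ L) = cong (xPowFact i (g i) *P_) (prodP-singletons L)

    Y≡zeros : ∀ L → Y L ≡ zeros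
    Y≡zeros []      = refl
    Y≡zeros (i ∷ L) = trans (cong (Vec.zipWith ℕ._+_ zeros) (Y≡zeros L))
                            (VecP.zipWith-identityˡ ℕP.+-identityˡ zeros)

    C≡ : C (allFin n) ≡ prod λ i → 1/ g i !
    C≡ = go id
      where
      go : ∀ {m} (h : Fin m → Fin n) → C (List.tabulate h) ≡ prod λ i → 1/ g (h i) !
      go {zero}  h = refl
      go {suc m} h = cong (1/ g (h zero) ! *_) (go (h ∘ suc))

    X≡ : X (allFin n) ≡ tabulate g
    X≡ = vec-ext λ j → trans (lookup-X j (allFin n)) (trans (sumℕ-allFin λ i → lookup (single i) j)
      (trans (ℕsum-single j λ i i≢j → single-≢ (i≢j ∘ sym)) (trans (single-≡ j) (sym (VecP.lookup∘tabulate g j)))))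
      where
      lookup-X : ∀ j L → lookup (X L) j ≡ sumℕ (map (λ i → lookup (single i) j) L)
      lookup-X j []      = VecP.lookup-replicate j 0
      lookup-X j (i ∷ L) = trans (VecP.lookup-zipWith ℕ._+_ j (single i) (X L))
                                 (cong (lookup (single i) j ℕ.+_) (lookup-X j L))

    dcoeff-formula : ∀ x y → dcoeff monomial x y ≡ prod (λ i → 1/ g i !) * (w x (tabulate g) * w y zeros)
    dcoeff-formula x y = begin
      dcoeff monomial x y
        ≡⟨ cong (λ P → dcoeff P x y) (prodP-singletons L) ⟩
      C L * (w x (X L) * w y (Y L)) + 0ℚ
        ≡⟨ ℚP.+-identityʳ _ ⟩
      C L * (w x (X L) * w y (Y L))
        ≡⟨ cong₂ _*_ C≡ (cong₂ (λ u v → w x u * w y v) X≡ (Y≡zeros L)) ⟩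
      prod (λ i → 1/ g i !) * (w x (tabulate g) * w y zeros) ∎
      where L = allFin n

  dcoeff-monomial-y : ∀ x y → y ≢ zeros → dcoeff monomial x y ≡ 0ℚ
  dcoeff-monomial-y x y y≢0 = trans (dcoeff-formula x y)
    (trans (cong (p *_) (trans (cong (q *_) (w-≢ y zeros (y≢0 ∘ sym))) (ℚP.*-zeroʳ q))) (ℚP.*-zeroʳ p))
    where
    p = prod λ i → 1/ g i !
    q = w x (tabulate g)

  dcoeff-monomial-x : ∀ x y → x ≢ tabulate g → dcoeff monomial x y ≡ 0ℚ
  dcoeff-monomial-x x y x≢g = trans (dcoeff-formula x y)
    (trans (cong (p *_) (trans (cong (_* q) (w-≢ x (tabulate g) (x≢g ∘ sym))) (ℚP.*-zeroˡ q))) (ℚP.*-zeroʳ p))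
    where
    p = prod λ i → 1/ g i !
    q = w y zeros

  -- The denominators in `xPowFact` cancel the factorials in `dcoeff`. This is why Δₙ has divided
  -- power coefficients 0 and ±1 only.
  dcoeff-monomial : dcoeff monomial (tabulate g) zeros ≡ 1ℚ
  dcoeff-monomial = begin
    dcoeff monomial (tabulate g) zeros    ≡⟨ dcoeff-formula (tabulate g) zeros ⟩
    p * (q * w (zeros {n}) zeros)         ≡⟨ cong (λ u → p * (q * u)) (prod-one {n} λ j → cong (λ e → ℕtoℚ (w₁ e e)) (VecP.lookup-replicate {n = n} j 0)) ⟩
    p * (q * 1ℚ)                          ≡⟨ cong (p *_) (ℚP.*-identityʳ q) ⟩
    p * q                                 ≡⟨ prod-distrib-* (λ i → 1/ g i !) (λ i → ℕtoℚ (w₁ (lookup (tabulate g) i) (lookup (tabulate g) i))) ⟨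
    prod (λ i → 1/ g i ! * ℕtoℚ (w₁ (lookup (tabulate g) i) (lookup (tabulate g) i)))
      ≡⟨ prod-one factor ⟩
    1ℚ                                    ∎
    where
    p = prod λ i → 1/ g i !
    q = w (tabulate g) (tabulate g)
    factor : ∀ i → 1/ g i ! * ℕtoℚ (w₁ (lookup (tabulate g) i) (lookup (tabulate g) i)) ≡ 1ℚ
    factor i = trans (cong (λ e → 1/ g i ! * ℕtoℚ e)
                 (trans (w₁-diag (lookup (tabulate g) i)) (cong _! (VecP.lookup∘tabulate g i)))) (1/!*! (g i))

-- The exponents of the term of f in the Leibniz expansion of `Δ n`. Since n - 1 - f j is the
-- opposite of f j in `Fin n`, they form a permutation of 0 ... n-1 when f is injective.
stair : ∀ {n} → (Fin n → Fin n) → Vec ℕ n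
stair {n} f = tabulate λ j → n ∸ 1 ∸ toℕ (f j)

stair-opposite : ∀ {n} (f : Fin n → Fin n) j → lookup (stair f) j ≡ toℕ (opposite (f j))
stair-opposite {n} f j = trans (VecP.lookup∘tabulate _ j)
  (trans (ℕP.∸-+-assoc n 1 (toℕ (f j))) (sym (FinP.opposite-prop (f j))))

stair-injective : ∀ {n} {f g : Fin n → Fin n} → stair f ≡ stair g → f ≗ g
stair-injective {f = f} {g} eq j = begin
  f j                          ≡⟨ FinP.opposite-involutive (f j) ⟨
  opposite (opposite (f j))    ≡⟨ cong opposite (FinP.toℕ-injective (trans (sym (stair-opposite f j)) (trans (cong (λ x → lookup x j) eq) (stair-opposite g j)))) ⟩
  opposite (opposite (g j))    ≡⟨ FinP.opposite-involutive (g j) ⟩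
  g j                          ∎

module _ {n : ℕ} where
  private
    M : Vec (Fin n) n → Poly n
    M v = monomial λ i → n ∸ 1 ∸ toℕ (lookup v i)

    term : Vec ℕ n → Vec ℕ n → Vec (Fin n) n → ℚ
    term x y v = if injectiveᵇ v then sgnFun (lookup v) * dcoeff (M v) x y else 0ℚ

  -- Filtering by injectivity is traded for zero terms, so that the sum runs over all vectors and a
  -- single one can be isolated.
  dcoeff-Δ-sum : ∀ x y → dcoeff (Δ n) x y ≡ sumL (term x y) (allVecs n)
  dcoeff-Δ-sum x y = begin
    dcoeff (Δ n) x y
      ≡⟨ pair-sumP (λ v → sgnFun (lookup v) · M v) (perms n) _ ⟩
    sumL (λ v → dcoeff (sgnFun (lookup v) · M v) x y) (perms n)
      ≡⟨ sumL-cong (λ v → pair-· (sgnFun (lookup v)) (M v) _) (perms n) ⟩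
    sumL (λ v → sgnFun (lookup v) * dcoeff (M v) x y) (perms n)
      ≡⟨ sumL-filterᵇ (λ v → sgnFun (lookup v) * dcoeff (M v) x y) injectiveᵇ (allVecs n) ⟩
    sumL (term x y) (allVecs n) ∎

  dcoeff-Δ-support : ∀ x y → dcoeff (Δ n) x y ≢ 0ℚ →
    y ≡ zeros × ∃ λ f → Injective _≡_ _≡_ f × x ≡ stair f
  dcoeff-Δ-support x y d≢0 =
    let v , t≢0 = sumL≢0⇒∃ (term x y) (allVecs n) (d≢0 ∘ trans (dcoeff-Δ-sum x y))
    in go v (injectiveᵇ v) refl t≢0
    where
    go : ∀ v b → injectiveᵇ v ≡ b → (if b then sgnFun (lookup v) * dcoeff (M v) x y else 0ℚ) ≢ 0ℚ →
      y ≡ zeros × ∃ λ f → Injective _≡_ _≡_ f × x ≡ stair f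
    go v false _     t≢0 = contradiction refl t≢0
    go v true  v-inj t≢0 =
        decidable-stable (VecP.≡-dec ℕ._≟_ y zeros)
          (m≢0 ∘ dcoeff-monomial-y (λ i → n ∸ 1 ∸ toℕ (lookup v i)) x y)
      , lookup v
      , injectiveᵇ⁻ v v-inj
      , decidable-stable (VecP.≡-dec ℕ._≟_ x (stair (lookup v)))
          (m≢0 ∘ dcoeff-monomial-x (λ i → n ∸ 1 ∸ toℕ (lookup v i)) x y)
      where m≢0 = *-≢0ʳ (sgnFun (lookup v)) t≢0

  -- Different permutations give different exponents, so nothing cancels in the Leibniz expansion:
  -- only the term of f contributes.
  dcoeff-Δ-stair : ∀ f → Injective _≡_ _≡_ f → dcoeff (Δ n) (stair f) zeros ≡ sgnFun f
  dcoeff-Δ-stair f f-inj = begin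
    dcoeff (Δ n) (stair f) zeros    ≡⟨ dcoeff-Δ-sum (stair f) zeros ⟩
    sumL (term (stair f) zeros) (allVecs n)   ≡⟨ sumL-allVecs (term (stair f) zeros) u (λ v v≢u → others v v≢u (injectiveᵇ v)) ⟩
    term (stair f) zeros u          ≡⟨ cong (λ b → if b then sgnFun (lookup u) * dcoeff (M u) (stair f) zeros else 0ℚ) (injectiveᵇ⁺ u u-inj) ⟩
    sgnFun (lookup u) * dcoeff (M u) (stair f) zeros
      ≡⟨ cong₂ (λ s x → s * dcoeff (M u) x zeros) (sgnFun-cong u≗f) (VecP.tabulate-cong λ j → cong (λ k → n ∸ 1 ∸ toℕ k) (sym (u≗f j))) ⟩
    sgnFun f * dcoeff (M u) (stair (lookup u)) zeros
      ≡⟨ cong (sgnFun f *_) (dcoeff-monomial λ i → n ∸ 1 ∸ toℕ (lookup u i)) ⟩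
    sgnFun f * 1ℚ                   ≡⟨ ℚP.*-identityʳ (sgnFun f) ⟩
    sgnFun f                        ∎
    where
    u = tabulate f
    u≗f : lookup u ≗ f
    u≗f = VecP.lookup∘tabulate f
    u-inj : Injective _≡_ _≡_ (lookup u)
    u-inj {a} {b} eq = f-inj (trans (sym (u≗f a)) (trans eq (u≗f b)))
    others : ∀ v → v ≢ u → ∀ b →
      (if b then sgnFun (lookup v) * dcoeff (M v) (stair f) zeros else 0ℚ) ≡ 0ℚ
    others v v≢u false = refl
    others v v≢u true  = trans
      (cong (sgnFun (lookup v) *_)
        (dcoeff-monomial-x (λ i → n ∸ 1 ∸ toℕ (lookup v i)) (stair f) zeros λ eq →
          v≢u (trans (sym (VecP.tabulate∘lookup v))
            (VecP.tabulate-cong λ j → sym (stair-injective {f = f} {lookup v} eq j)))))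
      (ℚP.*-zeroʳ (sgnFun (lookup v)))

-- Alternation and harmonicity of Δₙ

lookup-inc : ∀ {n} (i : Fin n) k x → lookup (inc i k x) i ≡ lookup x i ℕ.+ k
lookup-inc i k x = VecP.lookup∘updateAt i x

lookup-inc-≢ : ∀ {n} {i j : Fin n} k x → j ≢ i → lookup (inc i k x) j ≡ lookup x j
lookup-inc-≢ {i = i} {j} k x j≢i = VecP.lookup∘updateAt′ j i j≢i x

injective⇒surjective : ∀ {n} (f : Fin n → Fin n) → Injective _≡_ _≡_ f → ∀ m → ∃ λ j → f j ≡ m
injective⇒surjective {suc n} f f-inj m with FinP.any? (λ j → f j Fin.≟ m)
... | yes hit = hit
... | no ¬hit = contradiction (FinP.injective⇒≤ {f = λ j → punchOut (m≢ j)} λ {a} {b} eq →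
    f-inj (FinP.punchOut-injective (m≢ a) (m≢ b) eq)) ℕP.1+n≰n
  where
  m≢ : ∀ j → m ≢ f j
  m≢ j eq = ¬hit (j , sym eq)

injective⇒permutation : ∀ {n} (f : Fin n → Fin n) → Injective _≡_ _≡_ f →
  ∃ λ (σ : Permutation′ n) → ∀ j → σ ⟨$⟩ʳ j ≡ f j
injective⇒permutation f f-inj =
  permutation f (proj₁ ∘ surj) (proj₂ ∘ surj) (λ j → f-inj (proj₂ (surj (f j)))) , λ _ → refl
  where surj = injective⇒surjective f f-inj

IsPerm : ∀ {n} → Vec ℕ n → Set
IsPerm {n} x = ∃ λ (σ : Permutation′ n) → ∀ j → lookup x j ≡ toℕ (σ ⟨$⟩ʳ j)

IsPerm-injective : ∀ {n} {x : Vec ℕ n} → IsPerm x → Injective _≡_ _≡_ (lookup x)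
IsPerm-injective (σ , x≡σ) {a} {b} eq =
  permutation-injective σ (FinP.toℕ-injective (trans (sym (x≡σ a)) (trans eq (x≡σ b))))

bounded∧injective⇒IsPerm : ∀ {n} {x : Vec ℕ n} →
  (∀ j → lookup x j < n) → Injective _≡_ _≡_ (lookup x) → IsPerm x
bounded∧injective⇒IsPerm {x = x} x<n x-inj =
  let σ , σ≡f = injective⇒permutation f f-inj
  in σ , λ j → trans (sym (FinP.toℕ-fromℕ< (x<n j))) (cong toℕ (sym (σ≡f j)))
  where
  f = λ j → fromℕ< (x<n j)
  f-inj : Injective _≡_ _≡_ f
  f-inj {a} {b} eq = x-inj (trans (sym (FinP.toℕ-fromℕ< (x<n a)))
    (trans (cong toℕ eq) (FinP.toℕ-fromℕ< (x<n b))))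

opposite-injective : ∀ {n} {a b : Fin n} → opposite a ≡ opposite b → a ≡ b
opposite-injective {a = a} {b} eq = trans (sym (FinP.opposite-involutive a))
  (trans (cong opposite eq) (FinP.opposite-involutive b))

permute-zeros : ∀ {n} (σ : Permutation′ n) → permute σ zeros ≡ zeros
permute-zeros σ = vec-ext λ j → trans (lookup-permute σ zeros j)
  (trans (VecP.lookup-replicate (σ ⟨$⟩ʳ j) 0) (sym (VecP.lookup-replicate j 0)))

permute-flip : ∀ {n} (σ : Permutation′ n) x → permute (flip σ) (permute σ x) ≡ x
permute-flip σ x = vec-ext λ j → trans (lookup-permute (flip σ) (permute σ x) j)
  (trans (lookup-permute σ x (σ ⟨$⟩ˡ j)) (cong (lookup x) (inverseʳ σ)))

permute-stair : ∀ {n} (σ : Permutation′ n) f → permute σ (stair f) ≡ stair (f ∘ (σ ⟨$⟩ʳ_))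
permute-stair σ f = VecP.tabulate-cong λ j → VecP.lookup∘tabulate _ (σ ⟨$⟩ʳ j)

dcoeff-Δ-IsPerm : ∀ {n} x y → dcoeff (Δ n) x y ≢ 0ℚ → y ≡ zeros × IsPerm x
dcoeff-Δ-IsPerm {n} x y d≢0 = go (dcoeff-Δ-support x y d≢0)
  where
  go : ∀ {x y} → (y ≡ zeros × ∃ λ f → Injective _≡_ _≡_ f × x ≡ stair f) → y ≡ zeros × IsPerm {n} x
  go (y≡0 , f , f-inj , refl) =
    let σ , σ≡ = injective⇒permutation (opposite ∘ f) (f-inj ∘ opposite-injective)
    in y≡0 , σ , λ j → trans (stair-opposite f j) (cong toℕ (sym (σ≡ j)))

dcoeff-Δ≢0 : ∀ {n} {x : Vec ℕ n} → IsPerm x → dcoeff (Δ n) x zeros ≢ 0ℚ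
dcoeff-Δ≢0 {n} {x} (σ , x≡σ) d≡0 = sgnFun≢0 f (begin
  sgnFun f                         ≡⟨ dcoeff-Δ-stair f (permutation-injective σ ∘ opposite-injective) ⟨
  dcoeff (Δ n) (stair f) zeros     ≡⟨ cong (λ z → dcoeff (Δ n) z zeros) (vec-ext {x = x} {stair f} x≡stair) ⟨
  dcoeff (Δ n) x zeros             ≡⟨ d≡0 ⟩
  0ℚ                               ∎)
  where
  f = opposite ∘ (σ ⟨$⟩ʳ_)
  x≡stair : ∀ j → lookup x j ≡ lookup (stair f) j
  x≡stair j = trans (x≡σ j) (trans (cong toℕ (sym (FinP.opposite-involutive (σ ⟨$⟩ʳ j))))
    (sym (stair-opposite f j)))

-- On the support this is multiplicativity of the sign. Off the support both sides vanish: a nonzero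
-- value at the permuted exponents would be carried back to (x , y) by the inverse permutation.
dcoeff-Δ-permute : ∀ {n} (σ : Permutation′ n) x y →
  dcoeff (Δ n) (permute σ x) (permute σ y) ≡ sgn σ * dcoeff (Δ n) x y
dcoeff-Δ-permute {n} σ x y = go (D x y ℚP.≟ 0ℚ) (D (permute σ x) (permute σ y) ℚP.≟ 0ℚ)
  where
  D = dcoeff (Δ n)
  σx = permute σ x
  σy = permute σ y
  transport : ∀ (τ : Permutation′ n) x′ y′ → (y′ ≡ zeros × ∃ λ f → Injective _≡_ _≡_ f × x′ ≡ stair f) →
    D (permute τ x′) (permute τ y′) ≡ sgn τ * D x′ y′
  transport τ _ _ (refl , f , f-inj , refl) = begin
    D (permute τ (stair f)) (permute τ zeros)   ≡⟨ cong₂ D (permute-stair τ f) (permute-zeros τ) ⟩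
    D (stair (f ∘ (τ ⟨$⟩ʳ_))) zeros              ≡⟨ dcoeff-Δ-stair (f ∘ (τ ⟨$⟩ʳ_)) (permutation-injective τ ∘ f-inj) ⟩
    sgnFun (f ∘ (τ ⟨$⟩ʳ_))                       ≡⟨ sgnFun-∘ f f-inj τ ⟩
    sgnFun f * sgn τ                            ≡⟨ ℚP.*-comm (sgnFun f) (sgn τ) ⟩
    sgn τ * sgnFun f                            ≡⟨ cong (sgn τ *_) (dcoeff-Δ-stair f f-inj) ⟨
    sgn τ * D (stair f) zeros                   ∎
  go : Dec (D x y ≡ 0ℚ) → Dec (D (permute σ x) (permute σ y) ≡ 0ℚ) →
    D (permute σ x) (permute σ y) ≡ sgn σ * D x y
  go (no d≢0)  _ = transport σ x y (dcoeff-Δ-support x y d≢0)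
  go (yes d≡0) (yes d′≡0) = trans d′≡0 (sym (trans (cong (sgn σ *_) d≡0) (ℚP.*-zeroʳ (sgn σ))))
  go (yes d≡0) (no d′≢0) = contradiction (trans (sym (transport (flip σ) σx σy (dcoeff-Δ-support σx σy d′≢0)))
      (trans (cong₂ D (permute-flip σ x) (permute-flip σ y)) d≡0))
    (*-≢0 (sgnFun≢0 (flip σ ⟨$⟩ʳ_)) d′≢0)

-- Exchanging two equal entries fixes x, so only the place of the increment moves.
inc-transpose : ∀ {n} {i j : Fin n} a x → i ≢ j → lookup x i ≡ lookup x j →
  permute (Perm.transpose i j) (inc i a x) ≡ inc j a x
inc-transpose {i = i} {j} a x i≢j xi≡xj =
  vec-ext λ m → trans (lookup-permute (Perm.transpose i j) (inc i a x) m) (go m (m Fin.≟ i) (m Fin.≟ j))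
  where
  go : ∀ m → Dec (m ≡ i) → Dec (m ≡ j) → lookup (inc i a x) (PC.transpose i j m) ≡ lookup (inc j a x) m
  go m (yes refl) _ = begin
    lookup (inc i a x) (PC.transpose i j i)   ≡⟨ cong (lookup (inc i a x)) (transpose-ˡ i j) ⟩
    lookup (inc i a x) j                      ≡⟨ lookup-inc-≢ a x (i≢j ∘ sym) ⟩
    lookup x j                                ≡⟨ xi≡xj ⟨
    lookup x i                                ≡⟨ lookup-inc-≢ a x i≢j ⟨
    lookup (inc j a x) i                      ∎
  go m (no _) (yes refl) = begin
    lookup (inc i a x) (PC.transpose i j j)   ≡⟨ cong (lookup (inc i a x)) (transpose-ʳ i j) ⟩
    lookup (inc i a x) i                      ≡⟨ lookup-inc i a x ⟩
    lookup x i ℕ.+ a                          ≡⟨ cong (ℕ._+ a) xi≡xj ⟩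
    lookup x j ℕ.+ a                          ≡⟨ lookup-inc j a x ⟨
    lookup (inc j a x) j                      ∎
  go m (no m≢i) (no m≢j) = begin
    lookup (inc i a x) (PC.transpose i j m)   ≡⟨ cong (lookup (inc i a x)) (transpose-≢ m≢i m≢j) ⟩
    lookup (inc i a x) m                      ≡⟨ lookup-inc-≢ a x m≢i ⟩
    lookup x m                                ≡⟨ lookup-inc-≢ a x m≢j ⟨
    lookup (inc j a x) m                      ∎

-- If x has two equal entries, only these two can be raised to give a permutation, and the
-- results differ by a transposition.  If x has none, raising any entry of x to a permutation
-- leaves the old value of that entry to some other position, a contradiction.
alternating⇒harmonic : ∀ {n} (F : Vec ℕ n → ℚ) → (∀ x → F x ≢ 0ℚ → IsPerm x) →
  (∀ σ x → F (permute σ x) ≡ sgn σ * F x) → ∀ a → 0 < a → ∀ x → sum (λ i → F (inc i a x)) ≡ 0ℚ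
alternating⇒harmonic {n} F F-supp F-alt a 0<a x =
  go (FinP.any? λ i → FinP.any? λ j → ¬? (i Fin.≟ j) ×-dec (lookup x i ℕ.≟ lookup x j))
  where
  vanish : ∀ z → ¬ IsPerm z → F z ≡ 0ℚ
  vanish z ¬perm = decidable-stable (F z ℚP.≟ 0ℚ) (¬perm ∘ F-supp z)
  go : Dec (∃ λ i → ∃ λ j → i ≢ j × lookup x i ≡ lookup x j) → sum (λ i → F (inc i a x)) ≡ 0ℚ
  go (yes (i , j , i≢j , xi≡xj)) = begin
    sum (λ l → F (inc l a x))
      ≡⟨ sum-pair i≢j (λ l l≢i l≢j → vanish (inc l a x) λ perm → i≢j (IsPerm-injective {x = inc l a x} perm
           (trans (lookup-inc-≢ a x (l≢i ∘ sym)) (trans xi≡xj (sym (lookup-inc-≢ a x (l≢j ∘ sym))))))) ⟩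
    F (inc i a x) + F (inc j a x)
      ≡⟨ cong (F (inc i a x) +_) (trans (cong F (sym (inc-transpose a x i≢j xi≡xj))) (F-alt (Perm.transpose i j) (inc i a x))) ⟩
    F (inc i a x) + sgn (Perm.transpose i j) * F (inc i a x)
      ≡⟨ cong (λ s → F (inc i a x) + s * F (inc i a x)) (sgn-transpose i≢j) ⟩
    F (inc i a x) + - 1ℚ * F (inc i a x)
      ≡⟨ cong (F (inc i a x) +_) (ℚP.neg-distribˡ-* 1ℚ (F (inc i a x))) ⟨
    F (inc i a x) + - (1ℚ * F (inc i a x))
      ≡⟨ cong (λ q → F (inc i a x) + - q) (ℚP.*-identityˡ (F (inc i a x))) ⟩
    F (inc i a x) + - F (inc i a x)
      ≡⟨ ℚP.+-inverseʳ (F (inc i a x)) ⟩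
    0ℚ ∎
  go (no distinct) = sum-zero λ l → vanish (inc l a x) λ (σ , x≡σ) →
    let xl<σl : lookup x l < toℕ (σ ⟨$⟩ʳ l)
        xl<σl = subst (lookup x l <_) (trans (sym (lookup-inc l a x)) (x≡σ l)) (ℕP.m<m+n (lookup x l) 0<a)
        xl<n = ℕP.<-trans xl<σl (FinP.toℕ<n (σ ⟨$⟩ʳ l))
        j = σ ⟨$⟩ˡ fromℕ< xl<n
        σj≡xl : toℕ (σ ⟨$⟩ʳ j) ≡ lookup x l
        σj≡xl = trans (cong toℕ (inverseʳ σ)) (FinP.toℕ-fromℕ< xl<n)
        j≢l : j ≢ l
        j≢l j≡l = ℕP.<-irrefl (trans (sym σj≡xl) (cong (λ z → toℕ (σ ⟨$⟩ʳ z)) j≡l)) xl<σl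
    in distinct (j , l , j≢l , trans (sym (lookup-inc-≢ a x j≢l)) (trans (x≡σ j) σj≡xl))

dcoeff-Δ-harmonic : ∀ {n} a → 0 < a → ∀ x y → sum (λ i → dcoeff (Δ n) (inc i a x) y) ≡ 0ℚ
dcoeff-Δ-harmonic {n} a 0<a x y = go (VecP.≡-dec ℕ._≟_ y zeros)
  where
  D = dcoeff (Δ n)
  go : Dec (y ≡ zeros) → sum (λ i → D (inc i a x) y) ≡ 0ℚ
  go (yes refl) = alternating⇒harmonic (λ z → D z zeros)
    (λ z → proj₂ ∘ dcoeff-Δ-IsPerm z zeros)
    (λ σ z → trans (cong (D (permute σ z)) (sym (permute-zeros σ))) (dcoeff-Δ-permute σ z zeros))
    a 0<a x
  go (no y≢0) = sum-zero λ i →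
    decidable-stable (D (inc i a x) y ℚP.≟ 0ℚ) (y≢0 ∘ proj₁ ∘ dcoeff-Δ-IsPerm (inc i a x) y)

-- Shifts of exponent vectors and total degrees

inc-0 : ∀ {n} (i : Fin n) x → inc i 0 x ≡ x
inc-0 i x = VecP.updateAt-id-local i x (ℕP.+-identityʳ (lookup x i))

inc-inc : ∀ {n} (i : Fin n) a b x → inc i b (inc i a x) ≡ inc i (a ℕ.+ b) x
inc-inc i a b x = VecP.updateAt-updateAt-local i x (ℕP.+-assoc (lookup x i) a b)

inc-comm : ∀ {n} (i j : Fin n) a b x → inc i a (inc j b x) ≡ inc j b (inc i a x)
inc-comm i j a b x with i Fin.≟ j
... | no i≢j   = VecP.updateAt-commutes i j i≢j x
... | yes refl = trans (inc-inc i b a x)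
  (trans (cong (λ c → inc i c x) (ℕP.+-comm b a)) (sym (inc-inc i a b x)))

dec-inc : ∀ {n} (i : Fin n) b x → dec i 1 (inc i (suc b) x) ≡ inc i b x
dec-inc i b x = VecP.updateAt-updateAt-local i x (cong (_∸ 1) (ℕP.+-suc (lookup x i) b))

inc-dec : ∀ {n} (i : Fin n) x → lookup x i ≢ 0 → inc i 1 (dec i 1 x) ≡ x
inc-dec i x xi≢0 = trans (VecP.updateAt-updateAt i x) (VecP.updateAt-id-local i x (pred+1 (lookup x i) xi≢0))
  where
  pred+1 : ∀ m → m ≢ 0 → m ∸ 1 ℕ.+ 1 ≡ m
  pred+1 zero    m≢0 = contradiction refl m≢0
  pred+1 (suc m) m≢0 = ℕP.+-comm m 1

inc≡zeros : ∀ {n} (i : Fin n) b x → inc i b x ≡ zeros → x ≡ zeros × b ≡ 0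
inc≡zeros {n} i b x eq =
    vec-ext (λ j → trans (go j (j Fin.≟ i)) (sym (VecP.lookup-replicate j 0)))
  , ℕP.m+n≡0⇒n≡0 (lookup x i) xi+b≡0
  where
  entry : ∀ j → lookup (inc i b x) j ≡ 0
  entry j = trans (cong (λ z → lookup z j) eq) (VecP.lookup-replicate j 0)
  xi+b≡0 : lookup x i ℕ.+ b ≡ 0
  xi+b≡0 = trans (sym (lookup-inc i b x)) (entry i)
  go : ∀ j → Dec (j ≡ i) → lookup x j ≡ 0
  go j (yes refl) = ℕP.m+n≡0⇒m≡0 (lookup x i) xi+b≡0
  go j (no j≢i)   = trans (sym (lookup-inc-≢ b x j≢i)) (entry j)

unit : ∀ {n} → Fin n → Vec ℕ n
unit i = inc i 1 zeros

updateAt-permute : ∀ {n} (σ : Permutation′ n) i (f : ℕ → ℕ) x →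
  updateAt (permute σ x) i f ≡ permute σ (updateAt x (σ ⟨$⟩ʳ i) f)
updateAt-permute σ i f x =
  vec-ext λ j → trans (go j (j Fin.≟ i)) (sym (lookup-permute σ (updateAt x (σ ⟨$⟩ʳ i) f) j))
  where
  go : ∀ j → Dec (j ≡ i) →
    lookup (updateAt (permute σ x) i f) j ≡ lookup (updateAt x (σ ⟨$⟩ʳ i) f) (σ ⟨$⟩ʳ j)
  go j (yes refl) = trans (VecP.lookup∘updateAt i (permute σ x))
    (trans (cong f (lookup-permute σ x i)) (sym (VecP.lookup∘updateAt (σ ⟨$⟩ʳ i) x)))
  go j (no j≢i) = trans (VecP.lookup∘updateAt′ j i j≢i (permute σ x))
    (trans (lookup-permute σ x j)
      (sym (VecP.lookup∘updateAt′ (σ ⟨$⟩ʳ j) (σ ⟨$⟩ʳ i) (j≢i ∘ permutation-injective σ) x)))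

permute-unit : ∀ {n} (σ : Permutation′ n) i → permute σ (unit (σ ⟨$⟩ʳ i)) ≡ unit i
permute-unit σ i = trans (sym (updateAt-permute σ i (ℕ._+ 1) zeros)) (cong (inc i 1) (permute-zeros σ))

lookup-unit : ∀ {n} (i : Fin n) → lookup (unit i) i ≡ 1
lookup-unit i = trans (lookup-inc i 1 zeros) (cong (ℕ._+ 1) (VecP.lookup-replicate i 0))

lookup-unit-≢ : ∀ {n} {i j : Fin n} → j ≢ i → lookup (unit i) j ≡ 0
lookup-unit-≢ {j = j} j≢i = trans (lookup-inc-≢ 1 zeros j≢i) (VecP.lookup-replicate j 0)

sum-zeros : ∀ n → Vec.sum (zeros {n}) ≡ 0
sum-zeros zero    = refl
sum-zeros (suc n) = sum-zeros n

-- The old entry is added on the left instead of being subtracted on the right, which keeps the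
-- identity valid in ℕ when f lowers the entry.
sum-updateAt : ∀ {n} (i : Fin n) f x → Vec.sum (updateAt x i f) ℕ.+ lookup x i ≡ Vec.sum x ℕ.+ f (lookup x i)
sum-updateAt zero f (e ∷ x) =
  solve 3 (λ a b c → a :+ b :+ c := c :+ b :+ a) refl (f e) (Vec.sum x) e
  where open ℕS.+-*-Solver
sum-updateAt (suc i) f (e ∷ x) = trans (ℕP.+-assoc e _ _)
  (trans (cong (e ℕ.+_) (sum-updateAt i f x)) (sym (ℕP.+-assoc e _ _)))

sum-inc : ∀ {n} (i : Fin n) k x → Vec.sum (inc i k x) ≡ Vec.sum x ℕ.+ k
sum-inc i k x = ℕP.+-cancelʳ-≡ (lookup x i) _ _ (trans (sum-updateAt i (ℕ._+ k) x)
  (solve 3 (λ a b c → a :+ (b :+ c) := a :+ c :+ b) refl (Vec.sum x) (lookup x i) k))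
  where open ℕS.+-*-Solver

sum-unit : ∀ {n} (i : Fin n) → Vec.sum (unit i) ≡ 1
sum-unit {n} i = trans (sum-inc i 1 zeros) (cong (ℕ._+ 1) (sum-zeros n))

sum-lookup : ∀ {n} (x : Vec ℕ n) → Vec.sum x ≡ ℕSum.sum (lookup x)
sum-lookup []      = refl
sum-lookup (e ∷ x) = cong (e ℕ.+_) (sum-lookup x)

∑toℕ*2 : ∀ n → ℕSum.sum (toℕ {n}) ℕ.* 2 ≡ n ℕ.* (n ∸ 1)
∑toℕ*2 zero    = refl
∑toℕ*2 (suc n) = begin
  ℕSum.sum (λ (j : Fin n) → 1 ℕ.+ toℕ j) ℕ.* 2    ≡⟨ cong (ℕ._* 2) (ℕSum.∑-distrib-+ {n} (λ _ → 1) toℕ) ⟩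
  (ℕSum.sum (λ (j : Fin n) → 1) ℕ.+ S) ℕ.* 2      ≡⟨ cong (λ m → (m ℕ.+ S) ℕ.* 2) (ones n) ⟩
  (n ℕ.+ S) ℕ.* 2                                 ≡⟨ ℕP.*-distribʳ-+ 2 n S ⟩
  n ℕ.* 2 ℕ.+ S ℕ.* 2                             ≡⟨ cong (n ℕ.* 2 ℕ.+_) (∑toℕ*2 n) ⟩
  n ℕ.* 2 ℕ.+ n ℕ.* (n ∸ 1)                       ≡⟨ arith n ⟩
  suc n ℕ.* n                                     ∎
  where
  S = ℕSum.sum (toℕ {n})
  ones : ∀ m → ℕSum.sum (λ (j : Fin m) → 1) ≡ m
  ones zero    = refl
  ones (suc m) = cong suc (ones m)
  arith : ∀ m → m ℕ.* 2 ℕ.+ m ℕ.* (m ∸ 1) ≡ suc m ℕ.* m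
  arith zero    = refl
  arith (suc m) = solve 1 (λ m → (con 1 :+ m) :* con 2 :+ (con 1 :+ m) :* m
                              := (con 2 :+ m) :* (con 1 :+ m)) refl m
    where open ℕS.+-*-Solver

-- The degree in `Bihom` uses integer division by 2; it is exact because n(n-1) is twice the sum 0 +
-- ... + (n-1).
sum-IsPerm : ∀ {n} {x : Vec ℕ n} → IsPerm x → Vec.sum x ≡ n ℕ.* (n ∸ 1) DM./ 2
sum-IsPerm {n} {x} (σ , x≡σ) = begin
  Vec.sum x                             ≡⟨ sum-lookup x ⟩
  ℕSum.sum (lookup x)                   ≡⟨ ℕSum.sum-cong-≗ x≡σ ⟩
  ℕSum.sum (toℕ ∘ (σ ⟨$⟩ʳ_))            ≡⟨ ℕSum.sum-permute toℕ σ ⟨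
  ℕSum.sum (toℕ {n})                    ≡⟨ DM.m*n/n≡m (ℕSum.sum (toℕ {n})) 2 ⟨
  ℕSum.sum (toℕ {n}) ℕ.* 2 DM./ 2       ≡⟨ cong (DM._/ 2) (∑toℕ*2 n) ⟩
  n ℕ.* (n ∸ 1) DM./ 2                  ∎

-- The elements E_k Δₙ

Eᵈ : ∀ {n} → ℕ → (Vec ℕ n → Vec ℕ n → ℚ) → Vec ℕ n → Vec ℕ n → ℚ
Eᵈ k D x y = sum λ i → ℕtoℚ (lookup y i) * D (inc i k x) (dec i 1 y)

dcoeff-E : ∀ {n} k (P : Poly n) x y → dcoeff (E k P) x y ≡ Eᵈ k (dcoeff P) x y
dcoeff-E k P x y = trans (dcoeff-sumP (λ i → mulY i (∂ i k 0 P)) x y) (sum-cong-≗ λ i →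
  trans (dcoeff-mulY i (∂ i k 0 P) x y) (cong (ℕtoℚ (lookup y i) *_)
    (trans (dcoeff-∂ i k 0 P x (dec i 1 y)) (cong (dcoeff P (inc i k x)) (inc-0 i (dec i 1 y))))))

Eᵈ-permute : ∀ {n} k {D : Vec ℕ n → Vec ℕ n → ℚ} →
  (∀ σ x y → D (permute σ x) (permute σ y) ≡ sgn σ * D x y) →
  ∀ σ x y → Eᵈ k D (permute σ x) (permute σ y) ≡ sgn σ * Eᵈ k D x y
Eᵈ-permute k {D} D-permute σ x y = begin
  sum (λ i → ℕtoℚ (lookup (permute σ y) i) * D (inc i k (permute σ x)) (dec i 1 (permute σ y)))
    ≡⟨ sum-cong-≗ (λ i → cong₂ _*_ (cong ℕtoℚ (lookup-permute σ y i)) (trans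
         (cong₂ D (updateAt-permute σ i (ℕ._+ k) x) (updateAt-permute σ i (_∸ 1) y))
         (D-permute σ (inc (σ ⟨$⟩ʳ i) k x) (dec (σ ⟨$⟩ʳ i) 1 y)))) ⟩
  sum (λ i → c (σ ⟨$⟩ʳ i) * (sgn σ * d (σ ⟨$⟩ʳ i)))
    ≡⟨ sum-cong-≗ (λ i → move (c (σ ⟨$⟩ʳ i)) (sgn σ) (d (σ ⟨$⟩ʳ i))) ⟩
  sum (λ i → sgn σ * (c (σ ⟨$⟩ʳ i) * d (σ ⟨$⟩ʳ i)))
    ≡⟨ *-distribˡ-sum (sgn σ) (λ i → c (σ ⟨$⟩ʳ i) * d (σ ⟨$⟩ʳ i)) ⟨
  sgn σ * sum (λ i → c (σ ⟨$⟩ʳ i) * d (σ ⟨$⟩ʳ i))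
    ≡⟨ cong (sgn σ *_) (sum-permute (λ i → c i * d i) σ) ⟨
  sgn σ * sum (λ i → c i * d i) ∎
  where
  c = λ i → ℕtoℚ (lookup y i)
  d = λ i → D (inc i k x) (dec i 1 y)
  move : ∀ p q r → p * (q * r) ≡ q * (p * r)
  move p q r = trans (sym (ℚP.*-assoc p q r)) (trans (cong (_* r) (ℚP.*-comm p q)) (ℚP.*-assoc q p r))

module _ {n k : ℕ} {D : Vec ℕ n → Vec ℕ n → ℚ} (D-y : ∀ x y → D x y ≢ 0ℚ → y ≡ zeros) where

  private
    vanish : ∀ x y → y ≢ zeros → D x y ≡ 0ℚ
    vanish x y y≢0 = decidable-stable (D x y ℚP.≟ 0ℚ) (y≢0 ∘ D-y x y)

  -- For D free of y, the coefficient of y_i in E_k D is the k-th derivative of D in x_i.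
  Eᵈ-unit : ∀ x i → Eᵈ k D x (unit i) ≡ D (inc i k x) zeros
  Eᵈ-unit x i = begin
    Eᵈ k D x (unit i)
      ≡⟨ sum-single i (λ j j≢i → trans (cong (λ m → ℕtoℚ m * D (inc j k x) (dec j 1 (unit i))) (lookup-unit-≢ j≢i)) (ℚP.*-zeroˡ (D (inc j k x) (dec j 1 (unit i))))) ⟩
    ℕtoℚ (lookup (unit i) i) * D (inc i k x) (dec i 1 (unit i))
      ≡⟨ cong₂ (λ m y → ℕtoℚ m * D (inc i k x) y) (lookup-unit i) (trans (dec-inc i 0 zeros) (inc-0 i zeros)) ⟩
    1ℚ * D (inc i k x) zeros
      ≡⟨ ℚP.*-identityˡ _ ⟩
    D (inc i k x) zeros ∎

  Eᵈ-support : ∀ x y → Eᵈ k D x y ≢ 0ℚ → ∃ λ i → y ≡ unit i × D (inc i k x) zeros ≢ 0ℚ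
  Eᵈ-support x y e≢0 = go (sum≢0⇒∃ (λ i → ℕtoℚ (lookup y i) * D (inc i k x) (dec i 1 y)) e≢0)
    where
    go : (∃ λ i → ℕtoℚ (lookup y i) * D (inc i k x) (dec i 1 y) ≢ 0ℚ) →
      ∃ λ i → y ≡ unit i × D (inc i k x) zeros ≢ 0ℚ
    go (i , t≢0) = i
      , trans (sym (inc-dec i y yi≢0)) (cong (inc i 1) y-i≡0)
      , subst (λ z → D (inc i k x) z ≢ 0ℚ) y-i≡0 d≢0
      where
      d≢0 = *-≢0ʳ (ℕtoℚ (lookup y i)) t≢0
      y-i≡0 = D-y (inc i k x) (dec i 1 y) d≢0
      yi≢0 : lookup y i ≢ 0
      yi≢0 yi≡0 = t≢0 (trans (cong (λ m → ℕtoℚ m * D (inc i k x) (dec i 1 y)) yi≡0) (ℚP.*-zeroˡ (D (inc i k x) (dec i 1 y))))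

  -- Without y-derivatives, E_k commutes with ∑ ∂_{x_j}^a and D is harmonic. With one y-derivative
  -- the sum becomes ∑ ∂_{x_j}^{a+k} D, and 0 < k makes the order positive even for a = 0. Two or
  -- more kill E_k D, which is linear in y. In the clause for `suc b`, these last two cases are b =
  -- 0 and b ≠ 0.
  Eᵈ-harmonic : 0 < k → (∀ a → 0 < a → ∀ x y → sum (λ i → D (inc i a x) y) ≡ 0ℚ) →
    ∀ a b → 0 < a ℕ.+ b → ∀ x y → sum (λ j → Eᵈ k D (inc j a x) (inc j b y)) ≡ 0ℚ
  Eᵈ-harmonic 0<k D-harmonic a zero 0<a+0 x y = begin
    sum (λ j → Eᵈ k D (inc j a x) (inc j 0 y))
      ≡⟨ sum-cong-≗ (λ j → cong (Eᵈ k D (inc j a x)) (inc-0 j y)) ⟩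
    sum (λ j → sum λ i → c i * D (inc i k (inc j a x)) (dec i 1 y))
      ≡⟨ ∑-comm (λ j i → c i * D (inc i k (inc j a x)) (dec i 1 y)) ⟩
    sum (λ i → sum λ j → c i * D (inc i k (inc j a x)) (dec i 1 y))
      ≡⟨ sum-zero (λ i → begin
           sum (λ j → c i * D (inc i k (inc j a x)) (dec i 1 y))
             ≡⟨ sum-cong-≗ (λ j → cong (λ z → c i * D z (dec i 1 y)) (inc-comm i j k a x)) ⟩
           sum (λ j → c i * D (inc j a (inc i k x)) (dec i 1 y))
             ≡⟨ *-distribˡ-sum (c i) (λ j → D (inc j a (inc i k x)) (dec i 1 y)) ⟨
           c i * sum (λ j → D (inc j a (inc i k x)) (dec i 1 y))
             ≡⟨ cong (c i *_) (D-harmonic a 0<a (inc i k x) (dec i 1 y)) ⟩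
           c i * 0ℚ
             ≡⟨ ℚP.*-zeroʳ (c i) ⟩
           0ℚ ∎) ⟩
    0ℚ ∎
    where
    c = λ i → ℕtoℚ (lookup y i)
    0<a = subst (0 <_) (ℕP.+-identityʳ a) 0<a+0
  Eᵈ-harmonic 0<k D-harmonic a (suc b) _ x y = begin
    sum (λ j → Eᵈ k D (inc j a x) (inc j (suc b) y))
      ≡⟨ sum-cong-≗ diagonal ⟩
    sum (λ j → ℕtoℚ (lookup y j ℕ.+ suc b) * D (inc j (a ℕ.+ k) x) (inc j b y))
      ≡⟨ go (VecP.≡-dec ℕ._≟_ y zeros) (b ℕ.≟ 0) ⟩
    0ℚ ∎
    where
    diagonal : ∀ j → Eᵈ k D (inc j a x) (inc j (suc b) y)
      ≡ ℕtoℚ (lookup y j ℕ.+ suc b) * D (inc j (a ℕ.+ k) x) (inc j b y)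
    diagonal j = trans (sum-single j off)
      (cong₂ _*_ (cong ℕtoℚ (lookup-inc j (suc b) y)) (cong₂ D (inc-inc j a k x) (dec-inc j b y)))
      where
      off : ∀ i → i ≢ j →
        ℕtoℚ (lookup (inc j (suc b) y) i) * D (inc i k (inc j a x)) (dec i 1 (inc j (suc b) y)) ≡ 0ℚ
      off i i≢j = trans (cong (c *_) (vanish (inc i k (inc j a x)) y′ y′≢0)) (ℚP.*-zeroʳ c)
        where
        c = ℕtoℚ (lookup (inc j (suc b) y) i)
        y′ = dec i 1 (inc j (suc b) y)
        y′≢0 : y′ ≢ zeros
        y′≢0 eq = ℕP.m+1+n≢0 (lookup y j) (begin
          lookup y j ℕ.+ suc b          ≡⟨ lookup-inc j (suc b) y ⟨
          lookup (inc j (suc b) y) j    ≡⟨ VecP.lookup∘updateAt′ j i (i≢j ∘ sym) (inc j (suc b) y) ⟨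
          lookup y′ j                   ≡⟨ cong (λ z → lookup z j) eq ⟩
          lookup zeros j                ≡⟨ VecP.lookup-replicate j 0 ⟩
          0                             ∎)
    go : Dec (y ≡ zeros) → Dec (b ≡ 0) →
      sum (λ j → ℕtoℚ (lookup y j ℕ.+ suc b) * D (inc j (a ℕ.+ k) x) (inc j b y)) ≡ 0ℚ
    go (yes refl) (yes refl) = trans
      (sum-cong-≗ λ j → trans
        (cong₂ (λ m z → ℕtoℚ (m ℕ.+ 1) * D (inc j (a ℕ.+ k) x) z) (VecP.lookup-replicate j 0) (inc-0 j zeros))
        (ℚP.*-identityˡ (D (inc j (a ℕ.+ k) x) zeros)))
      (D-harmonic (a ℕ.+ k) (ℕP.<-≤-trans 0<k (ℕP.m≤n+m k a)) x zeros)
    go (no y≢0) _ = sum-zero λ j → trans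
      (cong (ℕtoℚ (lookup y j ℕ.+ suc b) *_) (vanish _ (inc j b y) (y≢0 ∘ proj₁ ∘ inc≡zeros j b y)))
      (ℚP.*-zeroʳ (ℕtoℚ (lookup y j ℕ.+ suc b)))
    go (yes _) (no b≢0) = sum-zero λ j → trans
      (cong (ℕtoℚ (lookup y j ℕ.+ suc b) *_) (vanish _ (inc j b y) (b≢0 ∘ proj₂ ∘ inc≡zeros j b y)))
      (ℚP.*-zeroʳ (ℕtoℚ (lookup y j ℕ.+ suc b)))

dcoeff-EΔ : ∀ {n} k x (i : Fin n) → dcoeff (E k (Δ n)) x (unit i) ≡ dcoeff (Δ n) (inc i k x) zeros
dcoeff-EΔ {n} k x i = trans (dcoeff-E k (Δ n) x (unit i))
  (Eᵈ-unit (λ x y → proj₁ ∘ dcoeff-Δ-IsPerm x y) x i)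

EΔ-InA : ∀ n k → 0 < k → InA n (ℤ.+ k) 1 (E k (Δ n))
EΔ-InA n k 0<k = harmonic , alternating , bihom
  where
  P = E k (Δ n)
  D = dcoeff (Δ n)
  D-y : ∀ x y → D x y ≢ 0ℚ → y ≡ zeros
  D-y x y = proj₁ ∘ dcoeff-Δ-IsPerm x y
  harmonic : Harmonic P
  harmonic a b 0<a+b = dcoeff⇒≈ (sumP (map (λ i → ∂ i a b P) (allFin n))) 0P λ x y → begin
    dcoeff (sumP (map (λ i → ∂ i a b P) (allFin n))) x y  ≡⟨ dcoeff-sumP (λ i → ∂ i a b P) x y ⟩
    sum (λ i → dcoeff (∂ i a b P) x y)
      ≡⟨ sum-cong-≗ (λ i → trans (dcoeff-∂ i a b P x y) (dcoeff-E k (Δ n) (inc i a x) (inc i b y))) ⟩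
    sum (λ i → Eᵈ k D (inc i a x) (inc i b y))            ≡⟨ Eᵈ-harmonic D-y 0<k dcoeff-Δ-harmonic a b 0<a+b x y ⟩
    0ℚ                                                    ∎
  alternating : Alternating P
  alternating σ = dcoeff⇒≈ (act σ P) (sgn σ · P) λ x y → begin
    dcoeff (act σ P) x y                     ≡⟨ dcoeff-act σ P x y ⟩
    dcoeff P (permute σ x) (permute σ y)     ≡⟨ dcoeff-E k (Δ n) (permute σ x) (permute σ y) ⟩
    Eᵈ k D (permute σ x) (permute σ y)       ≡⟨ Eᵈ-permute k dcoeff-Δ-permute σ x y ⟩
    sgn σ * Eᵈ k D x y                       ≡⟨ cong (sgn σ *_) (dcoeff-E k (Δ n) x y) ⟨
    sgn σ * dcoeff P x y                     ≡⟨ pair-· (sgn σ) P _ ⟨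
    dcoeff (sgn σ · P) x y                   ∎
  bihom : Bihom n (ℤ.+ k) 1 P
  bihom (x , y) c≢0 = go (Eᵈ-support D-y x y
      (coeff≢0⇒dcoeff≢0 P x y c≢0 ∘ trans (dcoeff-E k (Δ n) x y)))
    where
    go : (∃ λ i → y ≡ unit i × D (inc i k x) zeros ≢ 0ℚ) →
      (ℤ.+ Vec.sum x ≡ ℤ.+ (n ℕ.* (n ∸ 1) DM./ 2) ℤ.- ℤ.+ k) × Vec.sum y ≡ 1
    go (i , refl , d≢0) = degree , sum-unit i
      where
      degree : ℤ.+ Vec.sum x ≡ ℤ.+ (n ℕ.* (n ∸ 1) DM./ 2) ℤ.- ℤ.+ k
      degree = begin
        ℤ.+ Vec.sum x                                     ≡⟨ ℤP.+-identityʳ (ℤ.+ Vec.sum x) ⟨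
        ℤ.+ Vec.sum x ℤ.+ ℤ.0ℤ                            ≡⟨ cong (ℤ._+_ (ℤ.+ Vec.sum x)) (ℤP.+-inverseʳ (ℤ.+ k)) ⟨
        ℤ.+ Vec.sum x ℤ.+ (ℤ.+ k ℤ.- ℤ.+ k)               ≡⟨ ℤP.+-assoc (ℤ.+ Vec.sum x) (ℤ.+ k) (ℤ.- ℤ.+ k) ⟨
        ℤ.+ (Vec.sum x ℕ.+ k) ℤ.- ℤ.+ k                   ≡⟨ cong (λ m → ℤ.+ m ℤ.- ℤ.+ k) (sum-inc i k x) ⟨
        ℤ.+ Vec.sum (inc i k x) ℤ.- ℤ.+ k
          ≡⟨ cong (λ m → ℤ.+ m ℤ.- ℤ.+ k) (sum-IsPerm {x = inc i k x} (proj₂ (dcoeff-Δ-IsPerm (inc i k x) zeros d≢0))) ⟩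
        ℤ.+ (n ℕ.* (n ∸ 1) DM./ 2) ℤ.- ℤ.+ k              ∎

-- Newton's identities: vanishing of the power sums bounds the exponents

sumL-+ : ∀ {A : Set} (f g : A → ℚ) xs → sumL (λ i → f i + g i) xs ≡ sumL f xs + sumL g xs
sumL-+ f g []       = refl
sumL-+ f g (x ∷ xs) = trans (cong (f x + g x +_) (sumL-+ f g xs))
  (solve 4 (λ a b c d → a :+ b :+ (c :+ d) := a :+ c :+ (b :+ d)) refl (f x) (g x) (sumL f xs) (sumL g xs))
  where open ℚS.+-*-Solver

sumL-zero : ∀ {A : Set} {f : A → ℚ} → (∀ x → f x ≡ 0ℚ) → ∀ xs → sumL f xs ≡ 0ℚ
sumL-zero h []       = refl
sumL-zero h (x ∷ xs) = cong₂ _+_ (h x) (sumL-zero h xs)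

-- F is read as the linear functional on ℚ[x₁ … xₙ] with value F e on the monomial x^e.
module Newton {n : ℕ} (F : Vec ℕ n → ℚ) where

  -- H L r e is the value of F on x^e h_r(x_i : i ∈ L), with h_r the complete homogeneous
  -- symmetric polynomial.
  H : List (Fin n) → ℕ → Vec ℕ n → ℚ
  H L       zero    e = F e
  H []      (suc r) e = 0ℚ
  H (i ∷ L) (suc r) e = H L (suc r) e + H (i ∷ L) r (inc i 1 e)

  -- S L i k r e is the value of F on x^e ∑_{t ≤ r} x_i^{k+t} h_{r-t}(L).
  S : List (Fin n) → Fin n → ℕ → ℕ → Vec ℕ n → ℚ
  S L i k zero    e = H L zero (inc i k e)
  S L i k (suc r) e = H L (suc r) (inc i k e) + S L i (suc k) r e

  -- The recursion h_s(j ∷ L) = h_s(L) + x_j h_{s-1}(j ∷ L) is applied to every term with s > 0. The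
  -- last term has h_0 = 1 and is already part of `S L i k (suc r) e`.
  S-∷-suc : ∀ j L i k r e → S (j ∷ L) i k (suc r) e ≡ S L i k (suc r) e + S (j ∷ L) i k r (inc j 1 e)
  S-∷-suc j L i k zero e = trans
    (cong (λ z → H L 1 (inc i k e) + F z + F (inc i (suc k) e)) (inc-comm j i 1 k e))
    (solve 3 (λ a b c → a :+ b :+ c := a :+ c :+ b) refl
      (H L 1 (inc i k e)) (F (inc i k (inc j 1 e))) (F (inc i (suc k) e)))
    where open ℚS.+-*-Solver
  S-∷-suc j L i k (suc r) e = trans
    (cong₂ (λ z s → h + H (j ∷ L) (suc r) z + s) (inc-comm j i 1 k e) (S-∷-suc j L i (suc k) r e))
    (solve 4 (λ a b c d → a :+ b :+ (c :+ d) := a :+ c :+ (b :+ d)) refl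
      h (H (j ∷ L) (suc r) (inc i k (inc j 1 e))) (S L i (suc k) (suc r) e) (S (j ∷ L) i (suc k) r (inc j 1 e)))
    where
    open ℚS.+-*-Solver
    h = H L (suc (suc r)) (inc i k e)

  S-shift : ∀ L i k r e → S L i (suc k) r e ≡ S L i k r (inc i 1 e)
  S-shift L i k zero    e = cong F (sym (inc-inc i 1 k e))
  S-shift L i k (suc r) e = cong₂ _+_ (cong (H L (suc r)) (sym (inc-inc i 1 k e))) (S-shift L i (suc k) r e)

  -- This is (r+1) h_{r+1} = ∑ p_s h_{r+1-s}, 1 ≤ s ≤ r+1, with p_s the power sums of L. In the
  -- step, (r+2) h_{r+2}(j ∷ L) splits into (r+2) h_{r+2}(L), by induction on L, and r+2 copies of
  -- x_j h_{r+1}(j ∷ L): one is the leading term of the sum for j, the other r+1 fall under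
  -- induction on r.
  newton : ∀ L r e → ℕtoℚ (suc r) * H L (suc r) e ≡ sumL (λ i → S L i 1 r e) L
  newton []      r       e = ℚP.*-zeroʳ (ℕtoℚ (suc r))
  newton (j ∷ L) zero    e = begin
    ℕtoℚ 1 * (H L 1 e + F (inc j 1 e))
      ≡⟨ ℚP.*-distribˡ-+ (ℕtoℚ 1) (H L 1 e) (F (inc j 1 e)) ⟩
    ℕtoℚ 1 * H L 1 e + ℕtoℚ 1 * F (inc j 1 e)
      ≡⟨ cong₂ _+_ (newton L zero e) (ℚP.*-identityˡ (F (inc j 1 e))) ⟩
    sumL (λ i → S L i 1 zero e) L + F (inc j 1 e)
      ≡⟨ ℚP.+-comm _ (F (inc j 1 e)) ⟩
    F (inc j 1 e) + sumL (λ i → S L i 1 zero e) L ∎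
  newton (j ∷ L) (suc r) e = begin
    ℕtoℚ (suc (suc r)) * (h + g)
      ≡⟨ ℚP.*-distribˡ-+ (ℕtoℚ (suc (suc r))) h g ⟩
    ℕtoℚ (suc (suc r)) * h + ℕtoℚ (suc (suc r)) * g
      ≡⟨ cong₂ _+_ (newton L (suc r) e) (trans (cong (_* g) (ℕtoℚ-suc (suc r)))
           (trans (ℚP.*-distribʳ-+ g 1ℚ (ℕtoℚ (suc r)))
             (cong₂ _+_ (ℚP.*-identityˡ g) (newton (j ∷ L) r (inc j 1 e))))) ⟩
    A + (g + (b + B))
      ≡⟨ solve 4 (λ A g b B → A :+ (g :+ (b :+ B)) := g :+ b :+ (A :+ B)) refl A g b B ⟩
    (g + b) + (A + B)
      ≡⟨ cong₂ _+_ (cong (g +_) (S-shift (j ∷ L) j 1 r e)) (trans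
           (sumL-cong (λ i → S-∷-suc j L i 1 r e) L)
           (sumL-+ (λ i → S L i 1 (suc r) e) (λ i → S (j ∷ L) i 1 r (inc j 1 e)) L)) ⟨
    S (j ∷ L) j 1 (suc r) e + sumL (λ i → S (j ∷ L) i 1 (suc r) e) L ∎
    where
    open ℚS.+-*-Solver
    h = H L (suc (suc r)) e
    g = H (j ∷ L) (suc r) (inc j 1 e)
    A = sumL (λ i → S L i 1 (suc r) e) L
    b = S (j ∷ L) j 1 r (inc j 1 e)
    B = sumL (λ i → S (j ∷ L) i 1 r (inc j 1 e)) L

  H-last : ∀ j r e → H (j ∷ []) r e ≡ F (inc j r e)
  H-last j zero    e = cong F (sym (inc-0 j e))
  H-last j (suc r) e = trans (ℚP.+-identityˡ _)
    (trans (H-last j r (inc j 1 e)) (cong F (inc-inc j 1 r e)))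

  -- h_{r+1}(L) = h_{r+1}(i ∷ L) - x_i h_r(i ∷ L)
  H-drop : ∀ L K s → (∀ r e → s ≤ r → H (L ++ K) r e ≡ 0ℚ) →
    ∀ r e → List.length L ℕ.+ s ≤ r → H K r e ≡ 0ℚ
  H-drop []      K s h r e s≤r = h r e s≤r
  H-drop (i ∷ L) K s h r e l≤r =
    H-drop L K (suc s) step r e (subst (_≤ r) (sym (ℕP.+-suc (List.length L) s)) l≤r)
    where
    step : ∀ r e → suc s ≤ r → H (L ++ K) r e ≡ 0ℚ
    step (suc r) e (s≤s s≤r) = begin
      H (L ++ K) (suc r) e
        ≡⟨ ℚP.+-identityʳ _ ⟨
      H (L ++ K) (suc r) e + 0ℚ
        ≡⟨ cong (H (L ++ K) (suc r) e +_) (h r (inc i 1 e) s≤r) ⟨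
      H (i ∷ L ++ K) (suc r) e
        ≡⟨ h (suc r) e (ℕP.m≤n⇒m≤1+n s≤r) ⟩
      0ℚ ∎

  module _ (L : List (Fin n)) (power-sums : ∀ k → 0 < k → ∀ e → sumL (λ i → F (inc i k e)) L ≡ 0ℚ) where

    H-power-sums : ∀ K r k → 0 < k → ∀ e → sumL (λ i → H K r (inc i k e)) L ≡ 0ℚ
    H-power-sums K       zero    k 0<k e = power-sums k 0<k e
    H-power-sums []      (suc r) k 0<k e = sumL-zero (λ _ → refl) L
    H-power-sums (j ∷ K) (suc r) k 0<k e = trans
      (sumL-+ (λ i → H K (suc r) (inc i k e)) (λ i → H (j ∷ K) r (inc j 1 (inc i k e))) L)
      (cong₂ _+_ (H-power-sums K (suc r) k 0<k e)
        (trans (sumL-cong (λ i → cong (H (j ∷ K) r) (inc-comm j i 1 k e)) L)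
          (H-power-sums (j ∷ K) r k 0<k (inc j 1 e))))

    S-power-sums : ∀ K r k → 0 < k → ∀ e → sumL (λ i → S K i k r e) L ≡ 0ℚ
    S-power-sums K zero    k 0<k e = H-power-sums K zero k 0<k e
    S-power-sums K (suc r) k 0<k e = trans
      (sumL-+ (λ i → H K (suc r) (inc i k e)) (λ i → S K i (suc k) r e) L)
      (cong₂ _+_ (H-power-sums K (suc r) k 0<k e) (S-power-sums K r (suc k) (s≤s z≤n) e))

    -- Every term on the right of Newton's identity contains a power sum of positive degree, which F
    -- annihilates; in ℚ the factor r + 1 can be cancelled.
    H-vanishes : ∀ r e → 1 ≤ r → H L r e ≡ 0ℚ
    H-vanishes (suc r) e _ =
      *-cancelˡ-0 (ℕtoℚ≢0 (suc r)) (trans (newton L r e) (S-power-sums L r 1 (s≤s z≤n) e))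

Harmonicᵈ : ∀ {n} → (Vec ℕ n → ℚ) → Set
Harmonicᵈ F = ∀ a → 0 < a → ∀ x → sum (λ i → F (inc i a x)) ≡ 0ℚ

-- A power of x_0 is the complete symmetric polynomial in x_0 alone. For all m + 1 variables h_r is
-- annihilated from r = 1 on, and each of the m variables dropped raises this threshold by one. The
-- variable x_0 stands last in the list because `H-drop` removes variables from the front.
harmonic⇒bounded : ∀ {m} (F : Vec ℕ (suc m) → ℚ) → Harmonicᵈ F →
  ∀ x → suc m ≤ lookup x zero → F x ≡ 0ℚ
harmonic⇒bounded {m} F F-harm (e ∷ x) m<e = begin
  F (e ∷ x)                     ≡⟨⟩
  F (inc zero e (0 ∷ x))        ≡⟨ H-last zero e (0 ∷ x) ⟨
  H (zero ∷ []) e (0 ∷ x)       ≡⟨ H-drop L (zero ∷ []) 1 (H-vanishes (L ++ zero ∷ []) power-sums) e (0 ∷ x) l≤e ⟩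
  0ℚ                            ∎
  where
  open Newton F
  L : List (Fin (suc m))
  L = map suc (allFin m)
  l≤e : List.length L ℕ.+ 1 ≤ e
  l≤e = subst (_≤ e) (sym (trans (ℕP.+-comm _ 1) (cong suc
    (trans (ListP.length-map suc (allFin m)) (ListP.length-tabulate id))))) m<e
  power-sums : ∀ k → 0 < k → ∀ e → sumL (λ i → F (inc i k e)) (L ++ zero ∷ []) ≡ 0ℚ
  power-sums k 0<k y = begin
    sumL f (L ++ zero ∷ [])             ≡⟨ sumL-++ f L (zero ∷ []) ⟩
    sumL f L + (f zero + 0ℚ)            ≡⟨ cong₂ _+_ (trans (sumL-map f suc (allFin m)) (sumL-allFin (f ∘ suc))) (ℚP.+-identityʳ (f zero)) ⟩
    sum (f ∘ suc) + f zero              ≡⟨ ℚP.+-comm (sum (f ∘ suc)) (f zero) ⟩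
    sum f                               ≡⟨ F-harm k 0<k y ⟩
    0ℚ                                  ∎
    where
    f : Fin (suc m) → ℚ
    f i = F (inc i k y)

-- Uniqueness

degree₀ : ℕ → ℤ
degree₀ n = ℤ.+ (n ℕ.* (n ∸ 1) DM./ 2)

-- The families q i x = dcoeff P x (unit i) for P in the space InA n k 1.
record Family (n : ℕ) (k : ℤ) (q : Fin n → Vec ℕ n → ℚ) : Set where
  field
    alternating : ∀ σ i x → q i (permute σ x) ≡ sgn σ * q (σ ⟨$⟩ʳ i) x
    harmonic    : ∀ i → Harmonicᵈ (q i)
    total       : ∀ x → sum (λ i → q i x) ≡ 0ℚ
    degree      : ∀ i x → q i x ≢ 0ℚ → ℤ.+ Vec.sum x ≡ degree₀ n ℤ.- k

InA⇒Family : ∀ n k (P : Poly n) → InA n k 1 P → Family n k λ i x → dcoeff P x (unit i)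
InA⇒Family n k P (harm , alt , bihom) = record
  { alternating = λ σ i x → begin
      dcoeff P (permute σ x) (unit i)
        ≡⟨ cong (dcoeff P (permute σ x)) (permute-unit σ i) ⟨
      dcoeff P (permute σ x) (permute σ (unit (σ ⟨$⟩ʳ i)))
        ≡⟨ dcoeff-act σ P x (unit (σ ⟨$⟩ʳ i)) ⟨
      dcoeff (act σ P) x (unit (σ ⟨$⟩ʳ i))
        ≡⟨ ≈⇒dcoeff (act σ P) (sgn σ · P) (alt σ) x (unit (σ ⟨$⟩ʳ i)) ⟩
      dcoeff (sgn σ · P) x (unit (σ ⟨$⟩ʳ i))
        ≡⟨ pair-· (sgn σ) P _ ⟩
      sgn σ * dcoeff P x (unit (σ ⟨$⟩ʳ i)) ∎
  ; harmonic = λ i a 0<a x → trans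
      (sum-cong-≗ λ j → cong (dcoeff P (inc j a x)) (sym (inc-0 j (unit i))))
      (shifts a 0 (subst (0 <_) (sym (ℕP.+-identityʳ a)) 0<a) x (unit i))
  ; total = λ x → trans
      (sum-cong-≗ λ j → cong (λ z → dcoeff P z (unit j)) (sym (inc-0 j x)))
      (shifts 0 1 (s≤s z≤n) x zeros)
  ; degree = λ i x d≢0 → proj₁ (bihom (x , unit i) (dcoeff≢0⇒coeff≢0 P x (unit i) d≢0))
  }
  where
  shifts : ∀ a b → 0 < a ℕ.+ b → ∀ x y → sum (λ j → dcoeff P (inc j a x) (inc j b y)) ≡ 0ℚ
  shifts a b 0<a+b x y = begin
    sum (λ j → dcoeff P (inc j a x) (inc j b y))            ≡⟨ sum-cong-≗ (λ j → dcoeff-∂ j a b P x y) ⟨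
    sum (λ j → dcoeff (∂ j a b P) x y)                      ≡⟨ dcoeff-sumP (λ j → ∂ j a b P) x y ⟨
    dcoeff (sumP (map (λ j → ∂ j a b P) (allFin n))) x y
      ≡⟨ ≈⇒dcoeff (sumP (map (λ j → ∂ j a b P) (allFin n))) 0P (harm a b 0<a+b) x y ⟩
    0ℚ                                                      ∎

-- Uniqueness is obtained by applying the support argument to a difference P - c E_k Δₙ, which has
-- to be a family again.
Family-+* : ∀ {n k p r} c → Family n k p → Family n k r → Family n k λ i x → p i x + c * r i x
Family-+* {n} {k} {p} {r} c P R = record
  { alternating = λ σ i x → trans
      (cong₂ (λ u v → u + c * v) (P.alternating σ i x) (R.alternating σ i x))
      (solve 4 (λ s a c b → s :* a :+ c :* (s :* b) := s :* (a :+ c :* b)) refl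
        (sgn σ) (p (σ ⟨$⟩ʳ i) x) c (r (σ ⟨$⟩ʳ i) x))
  ; harmonic = λ i a 0<a x → linear (λ l → p i (inc l a x)) (λ l → r i (inc l a x))
      (P.harmonic i a 0<a x) (R.harmonic i a 0<a x)
  ; total = λ x → linear (λ l → p l x) (λ l → r l x) (P.total x) (R.total x)
  ; degree = λ i x d≢0 → deg i x d≢0 (p i x ℚP.≟ 0ℚ)
  }
  where
  module P = Family P
  module R = Family R
  open ℚS.+-*-Solver
  linear : ∀ (f g : Fin n → ℚ) → sum f ≡ 0ℚ → sum g ≡ 0ℚ → sum (λ l → f l + c * g l) ≡ 0ℚ
  linear f g f≡0 g≡0 = begin
    sum (λ l → f l + c * g l)        ≡⟨ ∑-distrib-+ f (λ l → c * g l) ⟩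
    sum f + sum (λ l → c * g l)      ≡⟨ cong₂ _+_ f≡0 (sym (*-distribˡ-sum c g)) ⟩
    0ℚ + c * sum g                   ≡⟨ ℚP.+-identityˡ _ ⟩
    c * sum g                        ≡⟨ cong (c *_) g≡0 ⟩
    c * 0ℚ                           ≡⟨ ℚP.*-zeroʳ c ⟩
    0ℚ                               ∎
  deg : ∀ i x → p i x + c * r i x ≢ 0ℚ → Dec (p i x ≡ 0ℚ) → ℤ.+ Vec.sum x ≡ degree₀ n ℤ.- k
  deg i x d≢0 (no p≢0)  = P.degree i x p≢0
  deg i x d≢0 (yes p≡0) = R.degree i x λ r≡0 →
    d≢0 (cong₂ _+_ p≡0 (trans (cong (c *_) r≡0) (ℚP.*-zeroʳ c)))

-- Support of a family

ident : ∀ {n} → Vec ℕ n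
ident = tabulate toℕ

ident-IsPerm : ∀ {n} → IsPerm (ident {n})
ident-IsPerm = Perm.id , VecP.lookup∘tabulate toℕ

-- The orbit representative: together with y_m it has exponent 0 at x_m, and the other exponents
-- miss exactly the value m.
base : ∀ {n} → Fin n → Vec ℕ n
base m = updateAt ident m λ _ → 0

inc-base : ∀ {n} (m : Fin n) → inc m (toℕ m) (base m) ≡ ident
inc-base m = trans (VecP.updateAt-updateAt m ident)
  (VecP.updateAt-id-local m ident (sym (VecP.lookup∘tabulate toℕ m)))

-- There are n values but only n - 1 positions other than i; were all values hit, punching out i
-- would embed `Fin (suc n)` into `Fin n`.
missing : ∀ {n} (i : Fin n) (x : Vec ℕ n) → ∃ λ (m : Fin n) → ∀ j → j ≢ i → lookup x j ≢ toℕ m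
missing {suc n} i x = go (FinP.¬∀⟶∃¬ (suc n) Hit hit? ¬all-hit)
  where
  Hit : Fin (suc n) → Set
  Hit m = ∃ λ j → j ≢ i × lookup x j ≡ toℕ m
  hit? : ∀ m → Dec (Hit m)
  hit? m = FinP.any? λ j → ¬? (j Fin.≟ i) ×-dec (lookup x j ℕ.≟ toℕ m)
  go : (∃ λ m → ¬ Hit m) → ∃ λ m → ∀ j → j ≢ i → lookup x j ≢ toℕ m
  go (m , ¬hit) = m , λ j j≢i eq → ¬hit (j , j≢i , eq)
  ¬all-hit : ¬ (∀ m → Hit m)
  ¬all-hit hit = ℕP.1+n≰n (FinP.injective⇒≤ {f = λ m → punchOut (i≢ m)} λ {a} {b} eq →
    FinP.toℕ-injective (trans (sym (proj₂ (proj₂ (hit a))))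
      (trans (cong (lookup x) (FinP.punchOut-injective (i≢ a) (i≢ b) eq)) (proj₂ (proj₂ (hit b))))))
    where
    i≢ : ∀ m → i ≢ proj₁ (hit m)
    i≢ m = proj₁ (proj₂ (hit m)) ∘ sym

transpose-fixed : ∀ {n} {a b : Fin n} x → a ≢ b → lookup x a ≡ lookup x b →
  permute (Perm.transpose a b) x ≡ x
transpose-fixed {a = a} {b} x a≢b xa≡xb = trans (cong (permute (Perm.transpose a b)) (sym (inc-0 a x)))
  (trans (inc-transpose 0 x a≢b xa≡xb) (inc-0 b x))

module Support {m : ℕ} {k : ℤ} {q : Fin (suc m) → Vec ℕ (suc m) → ℚ} (fam : Family (suc m) k q) where
  open Family fam
  private n = suc m

  vanishes : ∀ i x → (q i x ≢ 0ℚ → q i x ≡ 0ℚ) → q i x ≡ 0ℚ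
  vanishes i x h = decidable-stable (q i x ℚP.≟ 0ℚ) λ q≢0 → q≢0 (h q≢0)

  bounded : ∀ i x → q i x ≢ 0ℚ → ∀ j → lookup x j < n
  bounded i x q≢0 j = ℕP.≰⇒> λ n≤xj →
    let σ = Perm.transpose zero j
        -- The bound is available for x_0 only. Moving x_j there also moves the label of y, so i′ is
        -- chosen with σ i′ = i.
        i′ = PC.transpose j zero i
    in *-≢0 (sgnFun≢0 (σ ⟨$⟩ʳ_)) q≢0 (begin
      sgn σ * q i x                            ≡⟨ cong (λ l → sgn σ * q l x) (inverseʳ σ) ⟨
      sgn σ * q (σ ⟨$⟩ʳ i′) x                  ≡⟨ alternating σ i′ x ⟨
      q i′ (permute σ x)                       ≡⟨ harmonic⇒bounded (q i′) (harmonic i′) (permute σ x)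
                                                   (subst (n ≤_) (sym (trans (lookup-permute σ x zero) (cong (lookup x) (transpose-ˡ zero j)))) n≤xj) ⟩
      0ℚ                                       ∎)

  -- The transposition of a and b must fix the label i to give q i x = - q i x; hence a and b have
  -- to differ from i.
  distinct : ∀ i x → q i x ≢ 0ℚ → ∀ {a b} → a ≢ i → b ≢ i → lookup x a ≡ lookup x b → a ≡ b
  distinct i x q≢0 {a} {b} a≢i b≢i xa≡xb = decidable-stable (a Fin.≟ b) λ a≢b →
    let σ = Perm.transpose a b
    in q≢0 (p≡-p⇒p≡0 (begin
      q i x                        ≡⟨ cong (q i) (transpose-fixed x a≢b xa≡xb) ⟨
      q i (permute σ x)            ≡⟨ alternating σ i x ⟩
      sgn σ * q (σ ⟨$⟩ʳ i) x       ≡⟨ cong₂ (λ s l → s * q l x) (sgn-transpose a≢b) (transpose-≢ (a≢i ∘ sym) (b≢i ∘ sym)) ⟩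
      - 1ℚ * q i x                 ≡⟨ ℚP.neg-distribˡ-* 1ℚ (q i x) ⟨
      - (1ℚ * q i x)               ≡⟨ cong -_ (ℚP.*-identityˡ (q i x)) ⟩
      - q i x                      ∎))

  -- With the missing value v put in place of x_i, the exponents are a permutation of 0 ... n-1 and
  -- have sum n(n-1)/2. The sum of x itself is n(n-1)/2 - k, so v exceeds x_i by k.
  support : ∀ i x → q i x ≢ 0ℚ →
    ∃ λ (v : Fin n) → IsPerm (updateAt x i λ _ → toℕ v) × ℤ.+ toℕ v ≡ k ℤ.+ ℤ.+ lookup x i
  support i x q≢0 = go (missing i x)
    where
    go : (∃ λ (v : Fin n) → ∀ j → j ≢ i → lookup x j ≢ toℕ v) →
      ∃ λ (v : Fin n) → IsPerm (updateAt x i λ _ → toℕ v) × ℤ.+ toℕ v ≡ k ℤ.+ ℤ.+ lookup x i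
    go (v , v∉x) = v , perm , total-degree
      where
      z = updateAt x i λ _ → toℕ v
      zi : lookup z i ≡ toℕ v
      zi = VecP.lookup∘updateAt i x
      z≢ : ∀ {j} → j ≢ i → lookup z j ≡ lookup x j
      z≢ {j} j≢i = VecP.lookup∘updateAt′ j i j≢i x
      z<n : ∀ j → Dec (j ≡ i) → lookup z j < n
      z<n j (yes refl) = subst (_< n) (sym zi) (FinP.toℕ<n v)
      z<n j (no j≢i)   = subst (_< n) (sym (z≢ j≢i)) (bounded i x q≢0 j)
      z-inj : ∀ a b → Dec (a ≡ i) → Dec (b ≡ i) → lookup z a ≡ lookup z b → a ≡ b
      z-inj a b (yes refl) (yes refl) eq = refl
      z-inj a b (yes refl) (no b≢i)   eq = contradiction (trans (sym (z≢ b≢i)) (trans (sym eq) zi)) (v∉x b b≢i)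
      z-inj a b (no a≢i)   (yes refl) eq = contradiction (trans (sym (z≢ a≢i)) (trans eq zi)) (v∉x a a≢i)
      z-inj a b (no a≢i)   (no b≢i)   eq =
        distinct i x q≢0 a≢i b≢i (trans (sym (z≢ a≢i)) (trans eq (z≢ b≢i)))
      perm : IsPerm z
      perm = bounded∧injective⇒IsPerm {x = z} (λ j → z<n j (j Fin.≟ i))
        λ {a} {b} → z-inj a b (a Fin.≟ i) (b Fin.≟ i)
      N = n ℕ.* (n ∸ 1) DM./ 2
      sums : N ℕ.+ lookup x i ≡ Vec.sum x ℕ.+ toℕ v
      sums = trans (cong (ℕ._+ lookup x i) (sym (sum-IsPerm {x = z} perm))) (sum-updateAt i (λ _ → toℕ v) x)
      total-degree : ℤ.+ toℕ v ≡ k ℤ.+ ℤ.+ lookup x i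
      total-degree = GroupP.∙-cancelˡ (CommutativeRing.+-group ℤP.+-*-commutativeRing) (ℤ.+ N ℤ.- k) _ _ (begin
        ℤ.+ N ℤ.- k ℤ.+ ℤ.+ toℕ v                   ≡⟨ cong (ℤ._+ ℤ.+ toℕ v) (degree i x q≢0) ⟨
        ℤ.+ (Vec.sum x ℕ.+ toℕ v)                   ≡⟨ cong ℤ.+_ sums ⟨
        ℤ.+ N ℤ.+ ℤ.+ lookup x i                    ≡⟨ cong (λ z → ℤ.+ N ℤ.+ z) (ℤP.+-identityˡ (ℤ.+ lookup x i)) ⟨
        ℤ.+ N ℤ.+ (ℤ.0ℤ ℤ.+ ℤ.+ lookup x i)         ≡⟨ cong (λ z → ℤ.+ N ℤ.+ (z ℤ.+ ℤ.+ lookup x i)) (ℤP.+-inverseˡ k) ⟨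
        ℤ.+ N ℤ.+ (ℤ.- k ℤ.+ k ℤ.+ ℤ.+ lookup x i)  ≡⟨ cong (λ z → ℤ.+ N ℤ.+ z) (ℤP.+-assoc (ℤ.- k) k (ℤ.+ lookup x i)) ⟩
        ℤ.+ N ℤ.+ (ℤ.- k ℤ.+ (k ℤ.+ ℤ.+ lookup x i)) ≡⟨ ℤP.+-assoc (ℤ.+ N) (ℤ.- k) (k ℤ.+ ℤ.+ lookup x i) ⟨
        ℤ.+ N ℤ.- k ℤ.+ (k ℤ.+ ℤ.+ lookup x i)      ∎)

  -- Harmonicity under ∑ ∂_{x_l} moves the exponent of x_i to the other variables.
  lower : ∀ i v x → lookup x i ≡ v → q i x ≢ 0ℚ → ∃ λ x → lookup x i ≡ 0 × q i x ≢ 0ℚ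
  lower i zero    x xi≡v q≢0 = x , xi≡v , q≢0
  lower i (suc v) x xi≡v q≢0 =
    go (FinP.any? λ l → ¬? (l Fin.≟ i) ×-dec ¬? (q i (inc l 1 x′) ℚP.≟ 0ℚ))
    where
    x′ = dec i 1 x
    x′+1≡x : inc i 1 x′ ≡ x
    x′+1≡x = inc-dec i x λ xi≡0 → contradiction (trans (sym xi≡v) xi≡0) λ ()
    x′i : lookup x′ i ≡ v
    x′i = trans (VecP.lookup∘updateAt i x) (cong (_∸ 1) xi≡v)
    go : Dec (∃ λ l → l ≢ i × q i (inc l 1 x′) ≢ 0ℚ) → ∃ λ x → lookup x i ≡ 0 × q i x ≢ 0ℚ
    go (yes (l , l≢i , ql≢0)) =
      lower i v (inc l 1 x′) (trans (lookup-inc-≢ 1 x′ (l≢i ∘ sym)) x′i) ql≢0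
    go (no none) = contradiction (begin
      q i x                              ≡⟨ cong (q i) x′+1≡x ⟨
      q i (inc i 1 x′)                   ≡⟨ sum-single {f = λ l → q i (inc l 1 x′)} i (λ l l≢i → vanishes i (inc l 1 x′) λ ql≢0 → contradiction (l , l≢i , ql≢0) none) ⟨
      sum (λ l → q i (inc l 1 x′))       ≡⟨ harmonic i 1 (s≤s z≤n) x′ ⟩
      0ℚ                                 ∎) q≢0

  -- Once x_i = 0 the missing value is k. The permutation σ that lists x with v at place i then
  -- carries `base v` and the label v to x and the label i, so the value at the representative
  -- cannot vanish.
  at-base : ∀ i x → q i x ≢ 0ℚ → ∃ λ (v : Fin n) → k ≡ ℤ.+ toℕ v × q v (base v) ≢ 0ℚ
  at-base i x q≢0 = go (lower i (lookup x i) x refl q≢0)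
    where
    go : (∃ λ x → lookup x i ≡ 0 × q i x ≢ 0ℚ) → ∃ λ (v : Fin n) → k ≡ ℤ.+ toℕ v × q v (base v) ≢ 0ℚ
    go (x , xi≡0 , q≢0) = go′ (support i x q≢0)
      where
      go′ : (∃ λ (v : Fin n) → IsPerm (updateAt x i λ _ → toℕ v) × ℤ.+ toℕ v ≡ k ℤ.+ ℤ.+ lookup x i) →
        ∃ λ (v : Fin n) → k ≡ ℤ.+ toℕ v × q v (base v) ≢ 0ℚ
      go′ (v , (σ , z≡σ) , v≡) = v , k≡v , λ qv≡0 → q≢0 (begin
        q i x                                ≡⟨ cong (q i) (vec-ext {x = permute σ (base v)} {x} (λ j → trans (lookup-permute σ (base v) j) (entry j (j Fin.≟ i)))) ⟨
        q i (permute σ (base v))             ≡⟨ alternating σ i (base v) ⟩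
        sgn σ * q (σ ⟨$⟩ʳ i) (base v)        ≡⟨ cong (λ l → sgn σ * q l (base v)) σi≡v ⟩
        sgn σ * q v (base v)                 ≡⟨ cong (sgn σ *_) qv≡0 ⟩
        sgn σ * 0ℚ                           ≡⟨ ℚP.*-zeroʳ (sgn σ) ⟩
        0ℚ                                   ∎)
        where
        k≡v : k ≡ ℤ.+ toℕ v
        k≡v = trans (sym (ℤP.+-identityʳ k)) (trans (cong (λ e → k ℤ.+ ℤ.+ e) (sym xi≡0)) (sym v≡))
        σi≡v : σ ⟨$⟩ʳ i ≡ v
        σi≡v = FinP.toℕ-injective (trans (sym (z≡σ i)) (VecP.lookup∘updateAt i x))
        entry : ∀ j → Dec (j ≡ i) → lookup (base v) (σ ⟨$⟩ʳ j) ≡ lookup x j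
        entry j (yes refl) = trans (cong (lookup (base v)) σi≡v)
          (trans (VecP.lookup∘updateAt v ident) (sym xi≡0))
        entry j (no j≢i) = begin
          lookup (base v) (σ ⟨$⟩ʳ j)                 ≡⟨ VecP.lookup∘updateAt′ (σ ⟨$⟩ʳ j) v (λ σj≡v → j≢i (permutation-injective σ (trans σj≡v (sym σi≡v)))) ident ⟩
          lookup ident (σ ⟨$⟩ʳ j)                    ≡⟨ VecP.lookup∘tabulate toℕ (σ ⟨$⟩ʳ j) ⟩
          toℕ (σ ⟨$⟩ʳ j)                             ≡⟨ z≡σ j ⟨
          lookup (updateAt x i λ _ → toℕ v) j        ≡⟨ VecP.lookup∘updateAt′ j i j≢i x ⟩
          lookup x j                                 ∎

sum-const : ∀ n c → sum {n} (λ _ → c) ≡ ℕtoℚ n * c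
sum-const zero    c = sym (ℚP.*-zeroˡ c)
sum-const (suc n) c = begin
  c + sum {n} (λ _ → c)       ≡⟨ cong₂ _+_ (sym (ℚP.*-identityˡ c)) (sum-const n c) ⟩
  1ℚ * c + ℕtoℚ n * c         ≡⟨ ℚP.*-distribʳ-+ c 1ℚ (ℕtoℚ n) ⟨
  (1ℚ + ℕtoℚ n) * c           ≡⟨ cong (_* c) (ℕtoℚ-suc n) ⟨
  ℕtoℚ (suc n) * c            ∎

-- For k = 0 every q i is supported on permutations of 0, …, n-1, hence alternating, so that
-- q i ident does not depend on i.
module Degree-0 {m : ℕ} {q : Fin (suc m) → Vec ℕ (suc m) → ℚ} (fam : Family (suc m) ℤ.0ℤ q) where
  open Family fam
  open Support fam

  support₀ : ∀ i x → q i x ≢ 0ℚ → IsPerm x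
  support₀ i x q≢0 = go (support i x q≢0)
    where
    go : (∃ λ (v : Fin (suc m)) → IsPerm (updateAt x i λ _ → toℕ v) × ℤ.+ toℕ v ≡ ℤ.0ℤ ℤ.+ ℤ.+ lookup x i) → IsPerm x
    go (v , perm , v≡) = subst IsPerm (VecP.updateAt-id-local i x
      (ℤP.+-injective (trans v≡ (ℤP.+-identityˡ (ℤ.+ lookup x i))))) perm

  -- Lowering entry l of `ident` makes it equal to entry i, so in the sum of ∂_{x_j} at that point
  -- only j = i and j = l survive. Their values for q i are opposite, and the transposition of l and
  -- i identifies the one at j = i with - q l ident.
  adjacent : ∀ i l → toℕ l ≡ suc (toℕ i) → q l ident ≡ q i ident
  adjacent i l l≡1+i = begin
    q l ident          ≡⟨ GroupP.⁻¹-involutive ℚP.+-0-group (q l ident) ⟨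
    - - q l ident      ≡⟨ cong -_ swapped ⟨
    - q i (inc i 1 e)  ≡⟨ GroupP.inverseʳ-unique ℚP.+-0-group (q i (inc i 1 e)) (q i ident) (begin
        q i (inc i 1 e) + q i ident          ≡⟨ cong (λ x → q i (inc i 1 e) + q i x) e+1≡ident ⟨
        q i (inc i 1 e) + q i (inc l 1 e)    ≡⟨ sum-pair {f = λ j → q i (inc j 1 e)} i≢l (λ j j≢i j≢l → vanishes i (inc j 1 e) λ q≢0 → contradiction
                                                  (IsPerm-injective {x = inc j 1 e} (support₀ i (inc j 1 e) q≢0) (trans (lookup-inc-≢ 1 e (j≢i ∘ sym))
                                                    (trans ei≡el (sym (lookup-inc-≢ 1 e (j≢l ∘ sym)))))) i≢l) ⟨
        sum (λ j → q i (inc j 1 e))          ≡⟨ harmonic i 1 (s≤s z≤n) e ⟩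
        0ℚ                                   ∎) ⟨
    q i ident          ∎
    where
    e = dec l 1 ident
    i≢l : i ≢ l
    i≢l i≡l = ℕP.1+n≢n (trans (sym l≡1+i) (cong toℕ (sym i≡l)))
    identl : lookup ident l ≡ suc (toℕ i)
    identl = trans (VecP.lookup∘tabulate toℕ l) l≡1+i
    e+1≡ident : inc l 1 e ≡ ident
    e+1≡ident = inc-dec l ident λ l≡0 → contradiction (trans (sym identl) l≡0) λ ()
    ei≡el : lookup e i ≡ lookup e l
    ei≡el = trans (VecP.lookup∘updateAt′ i l i≢l ident) (trans (VecP.lookup∘tabulate toℕ i)
      (sym (trans (VecP.lookup∘updateAt l ident) (cong (_∸ 1) identl))))
    σ = Perm.transpose l i
    swapped : q i (inc i 1 e) ≡ - q l ident
    swapped = begin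
      q i (inc i 1 e)                    ≡⟨ cong (q i) (inc-transpose 1 e (i≢l ∘ sym) (sym ei≡el)) ⟨
      q i (permute σ (inc l 1 e))        ≡⟨ alternating σ i (inc l 1 e) ⟩
      sgn σ * q (σ ⟨$⟩ʳ i) (inc l 1 e)   ≡⟨ cong₂ _*_ (sgn-transpose (i≢l ∘ sym)) (cong₂ q (transpose-ʳ l i) e+1≡ident) ⟩
      - 1ℚ * q l ident                   ≡⟨ ℚP.neg-distribˡ-* 1ℚ (q l ident) ⟨
      - (1ℚ * q l ident)                 ≡⟨ cong -_ (ℚP.*-identityˡ (q l ident)) ⟩
      - q l ident                        ∎

  constant : ∀ v i → toℕ i ≡ v → q i ident ≡ q zero ident
  constant zero    zero    _    = refl
  constant (suc v) (suc i) 1+i≡ = trans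
    (adjacent (Fin.inject₁ i) (suc i) (cong suc (sym (FinP.toℕ-inject₁ i))))
    (constant v (Fin.inject₁ i) (trans (FinP.toℕ-inject₁ i) (ℕP.suc-injective 1+i≡)))

  ident-vanishes : q zero ident ≡ 0ℚ
  ident-vanishes = *-cancelˡ-0 (ℕtoℚ≢0 (suc m)) (begin
    ℕtoℚ (suc m) * q zero ident         ≡⟨ sum-const (suc m) (q zero ident) ⟨
    sum {suc m} (λ _ → q zero ident)    ≡⟨ sum-cong-≗ (λ i → constant (toℕ i) i refl) ⟨
    sum (λ i → q i ident)               ≡⟨ total ident ⟩
    0ℚ                                  ∎)

-- Both halves of the theorem rest on this: any nonzero value forces k into 1 ... n-1, and there a
-- single coefficient decides whether the family vanishes.
Family-support : ∀ {n k q} → Family n k q → ∀ i x → q i x ≢ 0ℚ →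
  ∃ λ (v : Fin n) → 0 < toℕ v × k ≡ ℤ.+ toℕ v × q v (base v) ≢ 0ℚ
Family-support {suc m} {k} {q} fam i x q≢0 = go (Support.at-base fam i x q≢0)
  where
  go : (∃ λ (v : Fin (suc m)) → k ≡ ℤ.+ toℕ v × q v (base v) ≢ 0ℚ) →
    ∃ λ (v : Fin (suc m)) → 0 < toℕ v × k ≡ ℤ.+ toℕ v × q v (base v) ≢ 0ℚ
  go (suc v , k≡v  , qv≢0) = suc v , s≤s z≤n , k≡v , qv≢0
  go (zero  , refl , q₀≢0) = contradiction (Degree-0.ident-vanishes fam) q₀≢0

-- From families back to polynomials

sum≡1⇒unit : ∀ {n} (y : Vec ℕ n) → Vec.sum y ≡ 1 → ∃ λ i → y ≡ unit i
sum≡1⇒unit (zero ∷ y) eq =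
  let i , y≡ = sum≡1⇒unit y eq in suc i , cong (0 ∷_) y≡
sum≡1⇒unit (suc zero ∷ y) eq = zero , cong (1 ∷_) (sum≡0 y (ℕP.suc-injective eq))
  where
  sum≡0 : ∀ {n} (y : Vec ℕ n) → Vec.sum y ≡ 0 → y ≡ zeros
  sum≡0 []         _  = refl
  sum≡0 (zero ∷ y) eq = cong (0 ∷_) (sum≡0 y eq)

y-degree : ∀ {n} k (P : Poly n) → Bihom n k 1 P → ∀ x y → Vec.sum y ≢ 1 → dcoeff P x y ≡ 0ℚ
y-degree k P bihom x y y≢1 = decidable-stable (dcoeff P x y ℚP.≟ 0ℚ)
  λ d≢0 → y≢1 (proj₂ (bihom (x , y) (dcoeff≢0⇒coeff≢0 P x y d≢0)))

≈-units : ∀ {n} k c (P Q : Poly n) → Bihom n k 1 P → Bihom n k 1 Q →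
  (∀ i x → dcoeff P x (unit i) ≡ c * dcoeff Q x (unit i)) → P ≈ (c · Q)
≈-units k c P Q P-bihom Q-bihom h = dcoeff⇒≈ P (c · Q) λ x y →
  trans (go x y (Vec.sum y ℕ.≟ 1)) (sym (pair-· c Q _))
  where
  go : ∀ x y → Dec (Vec.sum y ≡ 1) → dcoeff P x y ≡ c * dcoeff Q x y
  go x y (yes sum≡1) with sum≡1⇒unit y sum≡1
  ... | i , refl = h i x
  go x y (no sum≢1) = trans (y-degree k P P-bihom x y sum≢1)
    (sym (trans (cong (c *_) (y-degree k Q Q-bihom x y sum≢1)) (ℚP.*-zeroʳ c)))

EΔ-basis : ∀ n k → 1 ≤ k → k < n → IsBasis₁ (InA n (ℤ.+ k) 1) (E k (Δ n))
EΔ-basis n k 1≤k k<n = e∈A , e≉0 , spans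
  where
  e = E k (Δ n)
  e∈A = EΔ-InA n k 1≤k
  r = λ i x → dcoeff e x (unit i)
  κ = fromℕ< k<n
  r₀ = r κ (base κ)
  -- Raising the zero entry of `base κ` by k restores `ident`, so `r₀` is the coefficient of Δₙ at a
  -- permutation.
  r₀≢0 : r₀ ≢ 0ℚ
  r₀≢0 r₀≡0 = dcoeff-Δ≢0 {n} {ident} ident-IsPerm (begin
    dcoeff (Δ n) ident zeros                     ≡⟨ cong (λ x → dcoeff (Δ n) x zeros) (trans (cong (λ l → inc κ l (base κ)) (sym (FinP.toℕ-fromℕ< k<n))) (inc-base κ)) ⟨
    dcoeff (Δ n) (inc κ k (base κ)) zeros        ≡⟨ dcoeff-EΔ k (base κ) κ ⟨
    r₀                                           ≡⟨ r₀≡0 ⟩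
    0ℚ                                           ∎)
  e≉0 : ¬ (e ≈ 0P)
  e≉0 e≈0 = r₀≢0 (≈⇒dcoeff e 0P e≈0 (base κ) (unit κ))
  spans : ∀ P → InA n (ℤ.+ k) 1 P → Σ ℚ λ c → P ≈ (c · e)
  spans P P∈A = c , ≈-units (ℤ.+ k) c P e (proj₂ (proj₂ P∈A)) (proj₂ (proj₂ e∈A)) λ i x → begin
      p i x                              ≡⟨ solve 2 (λ a b → a := (a :+ :- b) :+ b) refl (p i x) (c * r i x) ⟩
      p i x + - (c * r i x) + c * r i x  ≡⟨ cong (λ s → p i x + s + c * r i x) (ℚP.neg-distribˡ-* c (r i x)) ⟩
      p i x + - c * r i x + c * r i x    ≡⟨ cong (_+ c * r i x) (q≡0 i x) ⟩
      0ℚ + c * r i x                     ≡⟨ ℚP.+-identityˡ (c * r i x) ⟩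
      c * r i x                          ∎
    where
    open ℚS.+-*-Solver
    instance _ = ℚ.≢-nonZero r₀≢0
    p = λ i x → dcoeff P x (unit i)
    -- The only possible ratio: it makes P - c e vanish at the representative, which
    -- `Family-support` turns into vanishing everywhere.
    c = p κ (base κ) * 1/ r₀
    q = λ i x → p i x + - c * r i x
    fam : Family n (ℤ.+ k) q
    fam = Family-+* (- c) (InA⇒Family n (ℤ.+ k) P P∈A) (InA⇒Family n (ℤ.+ k) e e∈A)
    q-base : q κ (base κ) ≡ 0ℚ
    q-base = begin
      p₀ + - (p₀ * 1/ r₀) * r₀     ≡⟨ solve 3 (λ a b d → a :+ :- (a :* b) :* d := a :+ :- (a :* (b :* d))) refl p₀ (1/ r₀) r₀ ⟩
      p₀ + - (p₀ * (1/ r₀ * r₀))   ≡⟨ cong (λ s → p₀ + - (p₀ * s)) (ℚP.*-inverseˡ r₀) ⟩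
      p₀ + - (p₀ * 1ℚ)             ≡⟨ cong (λ s → p₀ + - s) (ℚP.*-identityʳ p₀) ⟩
      p₀ + - p₀                    ≡⟨ ℚP.+-inverseʳ p₀ ⟩
      0ℚ                           ∎
      where p₀ = p κ (base κ)
    q≡0 : ∀ i x → q i x ≡ 0ℚ
    q≡0 i x = decidable-stable (q i x ℚP.≟ 0ℚ) λ q≢0 → go (Family-support fam i x q≢0)
      where
      go : ¬ (∃ λ (v : Fin n) → 0 < toℕ v × ℤ.+ k ≡ ℤ.+ toℕ v × q v (base v) ≢ 0ℚ)
      go (v , _ , k≡v , qv≢0) = qv≢0 (subst (λ l → q l (base l) ≡ 0ℚ)
        (FinP.toℕ-injective (trans (FinP.toℕ-fromℕ< k<n) (ℤP.+-injective k≡v))) q-base)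

InA-zero : ∀ n k → ¬ (ℤ.+ 1 ℤ.≤ k × k ℤ.≤ ℤ.+ (n ∸ 1)) → IsZeroSpace (InA n k 1)
InA-zero n k out P P∈A = dcoeff⇒≈ P 0P λ x y →
  decidable-stable (dcoeff P x y ℚP.≟ 0ℚ) λ d≢0 →
    let i , y≡ = sum≡1⇒unit y (proj₂ (proj₂ (proj₂ P∈A) (x , y) (dcoeff≢0⇒coeff≢0 P x y d≢0)))
    in go (Family-support (InA⇒Family n k P P∈A) i x (subst (λ y → dcoeff P x y ≢ 0ℚ) y≡ d≢0))
  where
  go : ¬ (∃ λ (v : Fin n) → 0 < toℕ v × k ≡ ℤ.+ toℕ v × dcoeff P (base v) (unit v) ≢ 0ℚ)
  go (v , 0<v , refl , _) = out (ℤ.+≤+ 0<v , ℤ.+≤+ (ℕP.<⇒≤pred (FinP.toℕ<n v)))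

open import Data.Integer using (+_)

mainTheorem4 : ∀ (n : ℕ) → 2 ≤ n →
    (∀ (k : ℕ) → 1 ≤ k → k ≤ n ∸ 1 → IsBasis₁ (InA n (+ k) 1) (E k (Δ n)))
    × (∀ (k : ℤ) → ¬ (Data.Integer._≤_ (+ 1) k × Data.Integer._≤_ k (+ (n ∸ 1)))
    → IsZeroSpace (InA n k 1))
-- Matching n as a successor lets n ∸ 1 compute, so that k ≤ n ∸ 1 becomes k < n.
mainTheorem4 n@(suc _) _ = (λ k 1≤k k≤n-1 → EΔ-basis n k 1≤k (s≤s k≤n-1)) , InA-zero n
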